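{- (1) $\mathcal{K}^{\mathsf{TJ}}(K_n)=\{k:k\ge1\}$ for every $n\ge1$. (2) $\mathcal{K}^{\mathsf{TJ}}(P_2)=\{k:k\ge1\}$, $\mathcal{K}^{\mathsf{TJ}}(P_n)=\{k:k\ge2\}$ for $n\ge3$; $\mathcal{K}^{\mathsf{TJ}}(C_3)=\{k:k\ge1\}$, $\mathcal{K}^{\mathsf{TJ}}(C_n)=\{k:k\ge2\}$ for $n\ge4$. (3) $\mathcal{K}^{\mathsf{TJ}}(K_{1,1})=\{k:k\ge1\}$, $\mathcal{K}^{\mathsf{TJ}}(K_{1,2})=\{k:k\ge2\}$, $\mathcal{K}^{\mathsf{TJ}}(K_{1,n})=\{k:k\ge n\}$ for $n\ge3$; and $\mathcal{K}^{\mathsf{TJ}}(K_{m,n})=\varnothing$ whenever $2\le m\le n$ and $n\ge3$. (4) $\mathcal{K}^{\mathsf{TJ}}(B_1)=\{k:k\ge1\}$, $\mathcal{K}^{\mathsf{TJ}}(B_2)=\{2\}$, and $\mathcal{K}^{\mathsf{TJ}}(B_p)=\varnothing$ for $p\ge3$. (5) $\mathcal{K}^{\mathsf{TJ}}(F_1)=\{k:k\ge1\}$ and $\mathcal{K}^{\mathsf{TJ}}(F_p)=\{k:k\ge p\}$ for $p\ge2$.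
   Context: All graphs are finite, simple, undirected. A $k$-clique of a graph $H$ is a set of $k$ pairwise adjacent vertices. For a graph $H$ and integer $k\ge1$, the Token Jumping graph $\mathsf{TJ}_k(H)$ has as vertices the $k$-cliques of $H$, and two $k$-cliques $A,B$ are adjacent iff $|A\cap B|=k-1$. For a graph $G$, $\mathcal{K}^{\mathsf{TJ}}(G)=\{k\ge1:\ \exists H,\ \mathsf{TJ}_k(H)\cong G\}$. $K_n$, $P_n$, $C_n$ denote the complete graph, path, cycle on $n$ vertices; $K_{m,n}$ the complete bipartite graph. The book graph $B_p$ consists of $p$ triangles sharing a common edge; the friendship graph $F_p$ consists of $p$ triangles sharing a common vertex. -}

module Defs where

open import Level using (0ℓ)
open import Data.Empty using (⊥)
open import Data.Fin using (Fin; toℕ)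
import Data.Fin.Properties as Fin
open import Data.Fin.Subset using (Subset; _∈_; _∩_; ∣_∣)
open import Data.Fin.Subset.Properties using (∩-comm; ∩-idem)
open import Data.Irrelevant using ([_])
open import Data.Nat using (ℕ; suc; _≤_; _≟_)
open import Data.Nat.Properties using (1+n≢n)
open import Data.Product using (_×_; _,_; ∃-syntax; proj₂)
open import Data.Refinement using (Refinement-syntax; value)
open import Data.Sum using (_⊎_; inj₁; inj₂; swap)
open import Data.Unit using (⊤; tt)
open import Function.Bundles using (_↔_; _⇔_; Inverse)
open import Relation.Binary using (Rel; Symmetric; Irreflexive; Decidable)
open import Relation.Binary.PropositionalEquality
  using (_≡_; _≢_; refl; sym; trans; cong; ≢-sym)
open import Relation.Nullary using (yes; no)
open import Relation.Nullary.Negation using (contradiction-irr)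
open import Relation.Nullary.Decidable using (_×-dec_; _⊎-dec_; ¬?)
open import Relation.Unary using (Pred)

record SimpleGraph (V : Set) : Set₁ where
  field
    Adj    : Rel V 0ℓ
    adj?   : Decidable Adj
    symm   : Symmetric Adj
    irrefl : Irreflexive _≡_ Adj

open SimpleGraph public

record _≅_ {V W : Set} (G : SimpleGraph V) (H : SimpleGraph W) : Set where
  field
    bijection : V ↔ W
  open Inverse bijection using (to) public
  field
    preserves : ∀ u v → Adj G u v ⇔ Adj H (to u) (to v)

infix 4 _≅_

IsClique : ∀ {n} → SimpleGraph (Fin n) → Subset n → Set
IsClique H S = ∀ {u v} → u ∈ S → v ∈ S → u ≢ v → Adj H u v

-- The proof component of a refinement type is irrelevant, so two k-cliques
-- are equal exactly when their underlying vertex sets are.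
KClique : ∀ {n} → SimpleGraph (Fin n) → ℕ → Set
KClique {n} H k = [ S ∈ Subset n ∣ IsClique H S × ∣ S ∣ ≡ k ]

-- The condition |A ∩ B| = k - 1 is written as suc ∣ A ∩ B ∣ ≡ k: with truncated
-- subtraction the unique 0-clique would be adjacent to itself.
TJ : ∀ {n} (k : ℕ) (H : SimpleGraph (Fin n)) → SimpleGraph (KClique H k)
TJ k H = record
  { Adj    = λ A B → suc ∣ value A ∩ value B ∣ ≡ k
  ; adj?   = λ A B → suc ∣ value A ∩ value B ∣ ≟ k
  ; symm   = λ {A} {B} eq →
      trans (cong (λ S → suc ∣ S ∣) (∩-comm (value B) (value A))) eq
  ; irrefl = λ { {A Data.Refinement., [ p ]} refl eq →
      contradiction-irr
        (trans (cong suc (trans (sym (proj₂ p)) (cong ∣_∣ (sym (∩-idem A))))) eq)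
        1+n≢n }
  }

-- Finite graphs H are taken, up to isomorphism, on a vertex set Fin n.
𝒦 : {V : Set} → SimpleGraph V → Pred ℕ _
𝒦 G k = 1 ≤ k × ∃[ n ] ∃[ H ] TJ {n} k H ≅ G

Complete : ∀ n → SimpleGraph (Fin n)
Complete n = record
  { Adj    = _≢_
  ; adj?   = λ i j → ¬? (i Fin.≟ j)
  ; symm   = ≢-sym
  ; irrefl = λ i≡j i≢j → i≢j i≡j
  }

Edgeless : ∀ n → SimpleGraph (Fin n)
Edgeless n = record
  { Adj    = λ _ _ → ⊥
  ; adj?   = λ _ _ → no λ ()
  ; symm   = λ ()
  ; irrefl = λ _ ()
  }

Path : ∀ n → SimpleGraph (Fin n)
Path n = record
  { Adj    = λ i j → suc (toℕ i) ≡ toℕ j ⊎ suc (toℕ j) ≡ toℕ i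
  ; adj?   = λ i j → (suc (toℕ i) ≟ toℕ j) ⊎-dec (suc (toℕ j) ≟ toℕ i)
  ; symm   = swap
  ; irrefl = λ { refl (inj₁ eq) → 1+n≢n eq ; refl (inj₂ eq) → 1+n≢n eq }
  }

CyclicSucc : ∀ {n} → Fin n → Fin n → Set
CyclicSucc {n} i j = suc (toℕ i) ≡ toℕ j ⊎ (suc (toℕ i) ≡ n × toℕ j ≡ 0)

cyclicSucc? : ∀ {n} → Decidable (CyclicSucc {n})
cyclicSucc? {n} i j =
  (suc (toℕ i) ≟ toℕ j) ⊎-dec ((suc (toℕ i) ≟ n) ×-dec (toℕ j ≟ 0))

-- The cycle C_n for n ≥ 3. The conjunct i ≢ j only has an effect when n = 1,
-- where it removes a loop.
Cycle : ∀ n → SimpleGraph (Fin n)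
Cycle n = record
  { Adj    = λ i j → i ≢ j × (CyclicSucc i j ⊎ CyclicSucc j i)
  ; adj?   = λ i j → ¬? (i Fin.≟ j) ×-dec (cyclicSucc? i j ⊎-dec cyclicSucc? j i)
  ; symm   = λ (i≢j , s) → ≢-sym i≢j , swap s
  ; irrefl = λ i≡j (i≢j , _) → i≢j i≡j
  }

module _ {V W : Set} (G : SimpleGraph V) (H : SimpleGraph W) where

  JoinAdj : Rel (V ⊎ W) 0ℓ
  JoinAdj (inj₁ u) (inj₁ v) = Adj G u v
  JoinAdj (inj₁ _) (inj₂ _) = ⊤
  JoinAdj (inj₂ _) (inj₁ _) = ⊤
  JoinAdj (inj₂ u) (inj₂ v) = Adj H u v

  private
    join? : Decidable JoinAdj
    join? (inj₁ u) (inj₁ v) = adj? G u v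
    join? (inj₁ _) (inj₂ _) = yes tt
    join? (inj₂ _) (inj₁ _) = yes tt
    join? (inj₂ u) (inj₂ v) = adj? H u v

    join-sym : Symmetric JoinAdj
    join-sym {inj₁ _} {inj₁ _} e = symm G e
    join-sym {inj₁ _} {inj₂ _} _ = tt
    join-sym {inj₂ _} {inj₁ _} _ = tt
    join-sym {inj₂ _} {inj₂ _} e = symm H e

    join-irrefl : Irreflexive _≡_ JoinAdj
    join-irrefl {inj₁ _} refl e = irrefl G refl e
    join-irrefl {inj₂ _} refl e = irrefl H refl e

  -- The graph join: the disjoint union together with all edges between V and W.
  Join : SimpleGraph (V ⊎ W)
  Join = record
    { Adj    = JoinAdj
    ; adj?   = join?
    ; symm   = λ {u} {v} → join-sym {u} {v}
    ; irrefl = λ {u} {v} → join-irrefl {u} {v}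
    }

CompleteBipartite : ∀ m n → SimpleGraph (Fin m ⊎ Fin n)
CompleteBipartite m n = Join (Edgeless m) (Edgeless n)

-- The common edge is Complete 2; each vertex of Edgeless p is the apex of one
-- of the p triangles.
Book : ∀ p → SimpleGraph (Fin 2 ⊎ Fin p)
Book p = Join (Complete 2) (Edgeless p)

-- p disjoint edges; the i-th one joins (i , 0) and (i , 1).
Matching : ∀ p → SimpleGraph (Fin p × Fin 2)
Matching p = record
  { Adj    = λ (i , a) (j , b) → i ≡ j × a ≢ b
  ; adj?   = λ (i , a) (j , b) → (i Fin.≟ j) ×-dec ¬? (a Fin.≟ b)
  ; symm   = λ (i≡j , a≢b) → sym i≡j , ≢-sym a≢b
  ; irrefl = λ { refl (_ , a≢a) → a≢a refl }
  }

-- The common vertex is Complete 1; each edge of Matching p is the side opposite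
-- to it in one of the p triangles.
Friendship : ∀ p → SimpleGraph (Fin 1 ⊎ (Fin p × Fin 2))
Friendship p = Join (Complete 1) (Matching p)

{-# OPTIONS --safe #-}
module Submission where

open import Defs
open import Data.Nat using (ℕ; _≤_)
open import Data.Product using (_×_)
open import Relation.Unary using (_≐_; ∅; ｛_｝)

import Data.Bool.Properties as Bool
open import Data.Empty using (⊥-elim)
open import Data.Fin
  using (Fin; zero; suc; toℕ; splitAt; join; _↑ˡ_; _↑ʳ_; inject₁; inject≤; fromℕ<)
import Data.Fin.Properties as Fin
open import Data.Fin.Subset
open import Data.Fin.Subset.Properties
open import Data.Irrelevant using ([_])
open import Data.Nat using (zero; suc; _+_; _<_; z≤n; s≤s; _≤′_; ≤′-refl; ≤′-step; _≟_)
open import Data.Nat.Properties hiding (_≟_)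
open import Data.Product using (_,_; ∃-syntax; proj₁; proj₂)
open import Data.Refinement using (value)
open import Data.Refinement.Properties using (value-injective)
import Data.Sum as Sum
open import Data.Sum using (_⊎_; inj₁; inj₂)
open import Data.Sum.Properties using (inj₂-injective) renaming (≡-dec to ⊎-≡-dec)
open import Data.Unit using (tt)
import Data.Vec as Vec
open import Data.Vec using ([]; _∷_; _++_; here; there)
open import Data.Vec.Properties
  using (∷-injectiveʳ; ++-injectiveʳ; lookup-++ˡ; lookup-++ʳ; lookup⇒[]=; []=⇒lookup; ≡-dec)
open import Function using (_∘_)
open import Function.Bundles using (_↔_; _⇔_; Equivalence; Inverse; mk⇔; mk↔ₛ′)
open import Function.Construct.Identity using (↔-id)
open import Function.Properties.Inverse using (↔-sym)
open import Relation.Binary.PropositionalEquality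
open import Relation.Nullary using (¬_; Dec; yes; no; contradiction)
open import Relation.Nullary.Decidable
  using (_×-dec_; _⊎-dec_; _→-dec_; ¬?; recompute; map′; decidable-stable; from-yes)

-- Lower bounds. Every neighbour of a k-clique A in TJ k H loses one element of A and gains one
-- element outside A; two neighbours that lose the same element, or gain the same element, are
-- equal or adjacent. So nonadjacent neighbours lose different elements (k ≥ n for stars and
-- friendship graphs), and two nonadjacent cliques have no three nonadjacent common neighbours.
-- Common neighbours of adjacent A = S + a and B = S + b come in two kinds, S + c and
-- S - s + a + b, each kind forming a clique, which rules out books with three pages; the second
-- kind makes A ∪ B a (k+1)-clique, which for k ≥ 3 forces a fifth vertex into Book 2.
-- Constructions. Adding a universal vertex to H raises k by one if H has no (k+1)-clique, so one
-- host for the least k suffices: an edgeless graph, a k-clique with tips, a path or a cycle. The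
-- paw, the host for Book 2 at k = 2, contains a triangle.

private
  variable
    k m n : ℕ
    V : Set
    P Q S : Subset n
    x y : Fin n

-- Sizes of finite subsets

∈∉⇒≢ : x ∈ P → y ∉ P → x ≢ y
∈∉⇒≢ x∈P x∉P refl = x∉P x∈P

x∉p-x : ∀ (P : Subset n) x → x ∉ P - x
x∉p-x (_ ∷ P) (suc x) (there x∈) = x∉p-x P x x∈

y∈p-x⇒y≢x : ∀ (P : Subset n) → y ∈ P - x → y ≢ x
y∈p-x⇒y≢x {x = x} P y∈ refl = x∉p-x P x y∈

∣p∣≤1+∣q∣ : ∀ x → (∀ {y} → y ∈ P → y ≢ x → y ∈ Q) → ∣ P ∣ ≤ suc ∣ Q ∣
∣p∣≤1+∣q∣ {P = P} {Q = Q} x P-x⊆Q with x ∈? P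
... | no x∉P  = m≤n⇒m≤1+n (p⊆q⇒∣p∣≤∣q∣ λ y∈P → P-x⊆Q y∈P (∈∉⇒≢ y∈P x∉P))
... | yes x∈P = ≤-trans (go P x x∈P) (s≤s (p⊆q⇒∣p∣≤∣q∣ λ y∈ →
                  P-x⊆Q (p─q⊆p P ⁅ x ⁆ y∈) (y∈p-x⇒y≢x P y∈)))
  where
  go : ∀ {n} (P : Subset n) x → x ∈ P → ∣ P ∣ ≤ suc ∣ P - x ∣
  -- Deleting the head leaves `P ─ ⊥` as the tail.
  go (.inside ∷ P) zero here = s≤s (≤-reflexive (cong ∣_∣ (sym (p─⊥≡p P))))
  go (inside  ∷ P) (suc x) (there x∈P) = s≤s (go P x x∈P)
  go (outside ∷ P) (suc x) (there x∈P) = go P x x∈P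

1+∣p-x∣≡∣p∣ : ∀ (P : Subset n) → x ∈ P → suc ∣ P - x ∣ ≡ ∣ P ∣
1+∣p-x∣≡∣p∣ {x = x} P x∈P =
  ≤-antisym (x∈p⇒∣p-x∣<∣p∣ x∈P) (∣p∣≤1+∣q∣ {P = P} x x∈p∧x≢y⇒x∈p-y)

p⊈q⇒∃ : ¬ P ⊆ Q → ∃[ x ] x ∈ P × x ∉ Q
p⊈q⇒∃ {P = P} {Q = Q} P⊈Q with Fin.any? (λ x → x ∈? P ×-dec ¬? (x ∈? Q))
... | yes found = found
... | no none   = contradiction
  (λ {x} x∈P → decidable-stable (x ∈? Q) λ x∉Q → none (x , x∈P , x∉Q)) P⊈Q

∣p∪⁅x⁆∣≡1+∣p∣ : ∀ (P : Subset n) → x ∉ P → ∣ P ∪ ⁅ x ⁆ ∣ ≡ suc ∣ P ∣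
∣p∪⁅x⁆∣≡1+∣p∣ {x = x} P x∉P = ≤-antisym
  (∣p∣≤1+∣q∣ x λ y∈ y≢x → in-P (x∈p∪q⁻ P ⁅ x ⁆ y∈) y≢x)
  (p⊂q⇒∣p∣<∣q∣ (p⊆p∪q ⁅ x ⁆ , x , x∈p∪q⁺ (inj₂ (x∈⁅x⁆ x)) , x∉P))
  where
  in-P : ∀ {y} → y ∈ P ⊎ y ∈ ⁅ x ⁆ → y ≢ x → y ∈ P
  in-P (inj₁ y∈P) _   = y∈P
  in-P (inj₂ y∈x) y≢x = contradiction (x∈⁅y⁆⇒x≡y x y∈x) y≢x

∣p∣>0⇒nonempty : ∀ (P : Subset n) → 0 < ∣ P ∣ → Nonempty P
∣p∣>0⇒nonempty {n} P 0<∣P∣ with nonempty? P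
... | yes ne = ne
... | no ¬ne rewrite Empty-unique ¬ne = contradiction 0<∣P∣ (<-irrefl (sym (∣⊥∣≡0 n)))

∣p∣≥∣q∣⇒p≡q : P ⊆ Q → ∣ Q ∣ ≤ ∣ P ∣ → P ≡ Q
∣p∣≥∣q∣⇒p≡q {P = P} {Q = Q} P⊆Q ∣Q∣≤∣P∣ with Q ⊆? P
... | yes Q⊆P = ⊆-antisym P⊆Q Q⊆P
... | no Q⊈P  = contradiction ∣Q∣≤∣P∣ (<⇒≱ (p⊂q⇒∣p∣<∣q∣ (P⊆Q , p⊈q⇒∃ Q⊈P)))

module _ {n : ℕ} {P Q : Subset n} (meet : suc ∣ P ∩ Q ∣ ≡ ∣ P ∣) where

  -- Otherwise `P ∩ Q` would be as large as `P`. For adjacent cliques the witness is the element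
  -- that `P` loses on the way to `Q`; with `P` and `Q` interchanged it is the element gained.
  exchange : ∃[ x ] x ∈ P × x ∉ Q
  exchange = p⊈q⇒∃ λ P⊆Q → 1+n≰n (≤-trans (≤-reflexive meet)
    (p⊆q⇒∣p∣≤∣q∣ λ x∈P → x∈p∩q⁺ (x∈P , P⊆Q x∈P)))

  -- Two different lost elements would confine `P ∩ Q` to `P - x - y`, which has two elements fewer
  -- than `P`.
  exchange-unique : ∀ {x y} → x ∈ P → x ∉ Q → y ∈ P → y ∉ Q → x ≡ y
  exchange-unique {x} {y} x∈P x∉Q y∈P y∉Q with x Fin.≟ y
  ... | yes x≡y = x≡y
  ... | no x≢y  = contradiction (p⊆q⇒∣p∣≤∣q∣ P∩Q⊆P-x-y) (<⇒≱ (≤-reflexive (suc-injective (begin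
      suc (suc ∣ P - x - y ∣) ≡⟨ cong suc (1+∣p-x∣≡∣p∣ (P - x) (x∈p∧x≢y⇒x∈p-y y∈P (≢-sym x≢y))) ⟩
      suc ∣ P - x ∣           ≡⟨ 1+∣p-x∣≡∣p∣ P x∈P ⟩
      ∣ P ∣                   ≡⟨ meet ⟨
      suc ∣ P ∩ Q ∣           ∎))))
    where
    open ≡-Reasoning
    P∩Q⊆P-x-y : P ∩ Q ⊆ P - x - y
    P∩Q⊆P-x-y z∈ =
      let z∈P , z∈Q = x∈p∩q⁻ P Q z∈
      in x∈p∧x≢y⇒x∈p-y (x∈p∧x≢y⇒x∈p-y z∈P (∈∉⇒≢ z∈Q x∉Q)) (∈∉⇒≢ z∈Q y∉Q)

-- If the bound were strict, `P ∩ Q` would have at least `k` elements and so equal both `P` and `Q`.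
-- Adjacency of distinct `k`-cliques thus reduces to a lower bound on their intersection.
meet⇐ : ∣ P ∣ ≡ k → ∣ Q ∣ ≡ k → P ≢ Q → k ≤ suc ∣ P ∩ Q ∣ → suc ∣ P ∩ Q ∣ ≡ k
meet⇐ {P = P} {k = k} {Q = Q} ∣P∣≡k ∣Q∣≡k P≢Q k≤ with m≤n⇒m<n∨m≡n k≤
... | inj₂ k≡   = sym k≡
... | inj₁ (s≤s k≤∣P∩Q∣) = contradiction (trans (sym P∩Q≡P) P∩Q≡Q) P≢Q
  where
  P∩Q≡P : P ∩ Q ≡ P
  P∩Q≡P = ∣p∣≥∣q∣⇒p≡q (p∩q⊆p P Q) (subst (_≤ _) (sym ∣P∣≡k) k≤∣P∩Q∣)
  P∩Q≡Q : P ∩ Q ≡ Q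
  P∩Q≡Q = ∣p∣≥∣q∣⇒p≡q (p∩q⊆q P Q) (subst (_≤ _) (sym ∣Q∣≡k) k≤∣P∩Q∣)

meet⇐lost : ∀ x → ∣ P ∣ ≡ k → ∣ Q ∣ ≡ k → P ≢ Q → (∀ {y} → y ∈ P → y ≢ x → y ∈ Q) →
  suc ∣ P ∩ Q ∣ ≡ k
meet⇐lost {P = P} {Q = Q} x ∣P∣≡k ∣Q∣≡k P≢Q P-x⊆Q = meet⇐ {P = P} {Q = Q} ∣P∣≡k ∣Q∣≡k P≢Q
  (≤-trans (≤-reflexive (sym ∣P∣≡k)) (∣p∣≤1+∣q∣ x λ y∈ y≢x → x∈p∩q⁺ (y∈ , P-x⊆Q y∈ y≢x)))

injection⇒≤∣p∣ : (f : Fin m → Fin n) → (∀ {i j} → f i ≡ f j → i ≡ j) → (∀ i → f i ∈ P) → m ≤ ∣ P ∣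
injection⇒≤∣p∣ {m = zero}  f f-inj f∈P = z≤n
injection⇒≤∣p∣ {m = suc m} f f-inj f∈P =
  ≤-trans (s≤s (injection⇒≤∣p∣ (f ∘ suc) (Fin.suc-injective ∘ f-inj) λ i →
            x∈p∧x≢y⇒x∈p-y (f∈P (suc i)) (Fin.0≢1+n ∘ sym ∘ f-inj)))
          (x∈p⇒∣p-x∣<∣p∣ (f∈P zero))

∣p∣≡1⇒singleton : ∀ (P : Subset n) → ∣ P ∣ ≡ 1 → ∃[ x ] P ≡ ⁅ x ⁆
∣p∣≡1⇒singleton P ∣P∣≡1 with x , x∈P ← ∣p∣>0⇒nonempty P (≤-reflexive (sym ∣P∣≡1)) =
  x , sym (∣p∣≥∣q∣⇒p≡q (λ y∈ → subst (_∈ _) (sym (x∈⁅y⁆⇒x≡y x y∈)) x∈P)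
                       (≤-reflexive (trans ∣P∣≡1 (sym (∣⁅x⁆∣≡1 x)))))

-- Representations

-- A k-clique assignment on the vertices of G that amounts to an isomorphism
-- TJ k H ≅ G; injectivity and surjectivity concern vertex sets only.
record Representation {V : Set} (G : SimpleGraph V) (k : ℕ) {n : ℕ} (H : SimpleGraph (Fin n)) : Set where
  field
    ⟦_⟧        : V → Subset n
    clique     : ∀ v → IsClique H ⟦ v ⟧
    size       : ∀ v → ∣ ⟦ v ⟧ ∣ ≡ k
    injective  : ∀ {u v} → ⟦ u ⟧ ≡ ⟦ v ⟧ → u ≡ v
    surjective : ∀ S → IsClique H S → ∣ S ∣ ≡ k → ∃[ v ] ⟦ v ⟧ ≡ S
    adj⇒meet   : ∀ {u v} → Adj G u v → suc ∣ ⟦ u ⟧ ∩ ⟦ v ⟧ ∣ ≡ k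
    meet⇒adj   : ∀ {u v} → suc ∣ ⟦ u ⟧ ∩ ⟦ v ⟧ ∣ ≡ k → Adj G u v

isClique? : (H : SimpleGraph (Fin n)) (S : Subset n) → Dec (IsClique H S)
isClique? H S = map′ (λ c {u} {v} → c u v) (λ c u v → c)
  (Fin.all? λ u → Fin.all? λ v → u ∈? S →-dec v ∈? S →-dec ¬? (u Fin.≟ v) →-dec adj? H u v)

mkClique : (H : SimpleGraph (Fin n)) (S : Subset n) → IsClique H S → ∣ S ∣ ≡ k → KClique H k
mkClique H S c s = S Data.Refinement., [ (λ {_} → c) , s ]

-- The proof inside a `KClique` is irrelevant; since both conditions are decidable, `recompute`
-- recovers a usable one.
kClique : (H : SimpleGraph (Fin n)) (A : KClique H k) → IsClique H (value A) × ∣ value A ∣ ≡ k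
kClique {k = k} H (S Data.Refinement., [ p ]) = recompute (isClique? H S ×-dec ∣ S ∣ ≟ k) p

module _ {V : Set} {G : SimpleGraph V} {k n : ℕ} {H : SimpleGraph (Fin n)} where

  ≅⇒representation : TJ k H ≅ G → Representation G k H
  ≅⇒representation iso = record
    { ⟦_⟧        = λ v → value (from v)
    ; clique     = λ v → proj₁ (kClique H (from v))
    ; size       = λ v → proj₂ (kClique H (from v))
    ; injective  = λ {u} {v} eq →
        trans (sym (strictlyInverseˡ u))
          (trans (cong to (value-injective {v = from u} {w = from v} eq)) (strictlyInverseˡ v))
    ; surjective = λ S c s → let A = mkClique H S c s in
        to A , cong value (strictlyInverseʳ A)
    ; adj⇒meet   = λ {u} {v} adj → Equivalence.from (preserves (from u) (from v))
        (subst₂ (Adj G) (sym (strictlyInverseˡ u)) (sym (strictlyInverseˡ v)) adj)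
    ; meet⇒adj   = λ {u} {v} meet →
        subst₂ (Adj G) (strictlyInverseˡ u) (strictlyInverseˡ v)
          (Equivalence.to (preserves (from u) (from v)) meet)
    }
    where
    open _≅_ iso using (bijection; preserves)
    open Inverse bijection

  representation⇒≅ : Representation G k H → TJ k H ≅ G
  representation⇒≅ R = record
    { bijection = mk↔ₛ′ to from (λ v → injective (⟦to⟧ (from v)))
        (λ A → value-injective {v = from (to A)} {w = A} (⟦to⟧ A))
    ; preserves = λ A B → mk⇔
        (λ meet → meet⇒adj (subst₂ (λ S T → suc ∣ S ∩ T ∣ ≡ k) (sym (⟦to⟧ A)) (sym (⟦to⟧ B)) meet))
        (λ adj → subst₂ (λ S T → suc ∣ S ∩ T ∣ ≡ k) (⟦to⟧ A) (⟦to⟧ B) (adj⇒meet adj))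
    }
    where
    open Representation R
    preimage : (A : KClique H k) → ∃[ v ] ⟦ v ⟧ ≡ value A
    preimage A = surjective (value A) (proj₁ (kClique H A)) (proj₂ (kClique H A))
    to : KClique H k → V
    to A = proj₁ (preimage A)
    ⟦to⟧ : ∀ A → ⟦ to A ⟧ ≡ value A
    ⟦to⟧ A = proj₂ (preimage A)
    from : V → KClique H k
    from v = mkClique H ⟦ v ⟧ (clique v) (size v)

-- Cliques are closed under subsets, so this also excludes all larger cliques.
Tight : SimpleGraph (Fin n) → ℕ → Set
Tight H k = ∀ S → IsClique H S → ∣ S ∣ ≢ suc k

-- Cones: adding a universal vertex

module _ {n : ℕ} (H : SimpleGraph (Fin n)) where

  ConeAdj : Fin (suc n) → Fin (suc n) → Set
  ConeAdj zero    zero    = Data.Empty.⊥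
  ConeAdj zero    (suc _) = Data.Unit.⊤
  ConeAdj (suc _) zero    = Data.Unit.⊤
  ConeAdj (suc u) (suc v) = Adj H u v

  Cone : SimpleGraph (Fin (suc n))
  Cone = record
    { Adj    = ConeAdj
    ; adj?   = λ { zero    zero    → no λ ()
                 ; zero    (suc _) → yes tt
                 ; (suc _) zero    → yes tt
                 ; (suc u) (suc v) → adj? H u v }
    ; symm   = λ { {zero}  {suc _} _ → tt
                 ; {suc _} {zero}  _ → tt
                 ; {suc u} {suc v} e → symm H e }
    ; irrefl = λ { {suc u} refl e → irrefl H refl e }
    }

  cone-clique⁺ : IsClique H S → IsClique Cone (inside ∷ S)
  cone-clique⁺ c here       here       u≢v = u≢v refl
  cone-clique⁺ c here       (there v∈) u≢v = tt
  cone-clique⁺ c (there u∈) here       u≢v = tt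
  cone-clique⁺ c (there u∈) (there v∈) u≢v = c u∈ v∈ (u≢v ∘ cong suc)

  cone-clique⁻ : ∀ s → IsClique Cone (s ∷ S) → IsClique H S
  cone-clique⁻ s c u∈ v∈ u≢v = c (there u∈) (there v∈) (u≢v ∘ Fin.suc-injective)

  -- A clique of size `k + 2` in the cone yields a clique of size `k + 1` in `H` by removing the
  -- apex or, if the apex is absent, any vertex.
  cone-tight : Tight H k → Tight Cone (suc k)
  cone-tight tight (inside  ∷ S) c eq = tight S (cone-clique⁻ inside c) (suc-injective eq)
  cone-tight tight (outside ∷ S) c eq
    with x , x∈S ← ∣p∣>0⇒nonempty S (subst (0 <_) (sym eq) (s≤s z≤n)) =
    tight (S - x)
      (λ u∈ v∈ → cone-clique⁻ outside c (p─q⊆p S ⁅ x ⁆ u∈) (p─q⊆p S ⁅ x ⁆ v∈))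
      (suc-injective (trans (1+∣p-x∣≡∣p∣ S x∈S) eq))

  -- By tightness every clique of size `k + 1` in the cone contains the apex. Removing it is a
  -- bijection onto the `k`-cliques of `H` that lowers all intersection sizes by one.
  cone-representation : {G : SimpleGraph V} →
    Representation G k H → Tight H k → Representation G (suc k) Cone
  cone-representation R tight = record
    { ⟦_⟧        = λ v → inside ∷ ⟦ v ⟧
    ; clique     = λ v → cone-clique⁺ (clique v)
    ; size       = λ v → cong suc (size v)
    ; injective  = injective ∘ ∷-injectiveʳ
    ; surjective = λ
        { (inside  ∷ S) c eq → let v , v≡ = surjective S (cone-clique⁻ inside c) (suc-injective eq)
                               in v , cong (inside ∷_) v≡
        ; (outside ∷ S) c eq → contradiction eq (tight S (cone-clique⁻ outside c)) }
    ; adj⇒meet   = cong suc ∘ adj⇒meet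
    ; meet⇒adj   = meet⇒adj ∘ suc-injective
    }
    where open Representation R

module _ {V : Set} {G : SimpleGraph V} where

  𝒦⇒representation : 𝒦 G k → ∃[ n ] ∃[ H ] Representation G k {n} H
  𝒦⇒representation (_ , n , H , iso) = n , H , ≅⇒representation iso

  representation⇒𝒦 : {H : SimpleGraph (Fin n)} → 1 ≤ k → Representation G k H → 𝒦 G k
  representation⇒𝒦 {H = H} 1≤k R = 1≤k , _ , H , representation⇒≅ R

  -- Cones of tight hosts are tight, so coning can be repeated from `k` up to `l`. The recursion is
  -- on `≤′`, whose steps raise the upper bound just as a cone does.
  tight⇒𝒦-upward : {H : SimpleGraph (Fin n)} →
    1 ≤ k → Representation G k H → Tight H k → ∀ {l} → k ≤ l → 𝒦 G l
  tight⇒𝒦-upward {k = k} 1≤k R tight k≤l =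
    let _ , _ , R′ , _ = raise (≤⇒≤′ k≤l) in representation⇒𝒦 (≤-trans 1≤k k≤l) R′
    where
    raise : ∀ {l} → k ≤′ l → ∃[ n ] ∃[ H ] Representation G l {n} H × Tight H l
    raise ≤′-refl      = _ , _ , R , tight
    raise (≤′-step k≤) =
      let _ , H , R′ , t = raise k≤ in _ , Cone H , cone-representation H R′ t , cone-tight H t

-- Neighbours in a representation

module _ {V : Set} {G : SimpleGraph V} {k n : ℕ} {H : SimpleGraph (Fin n)} (R : Representation G k H) where
  open Representation R

  private
    variable
      c d u v : V
      a b : Fin n

  meet-size : Adj G u v → suc ∣ ⟦ u ⟧ ∩ ⟦ v ⟧ ∣ ≡ ∣ ⟦ u ⟧ ∣
  meet-size {u} u~v = trans (adj⇒meet u~v) (sym (size u))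

  adj⇐ : u ≢ v → k ≤ suc ∣ ⟦ u ⟧ ∩ ⟦ v ⟧ ∣ → Adj G u v
  adj⇐ {u} {v} u≢v k≤ = meet⇒adj (meet⇐ {P = ⟦ u ⟧} (size u) (size v) (u≢v ∘ injective) k≤)

  -- For `k = 1` the bound in `adj⇐` is trivial: any two distinct singletons are adjacent.
  nonadjacent⇒2≤k : u ≢ v → ¬ Adj G u v → 1 ≤ k → 2 ≤ k
  nonadjacent⇒2≤k u≢v u≁v 1≤k with m≤n⇒m<n∨m≡n 1≤k
  ... | inj₁ 2≤k  = 2≤k
  ... | inj₂ refl = contradiction (adj⇐ u≢v (s≤s z≤n)) u≁v

  separated⇒≢ : a ∈ ⟦ u ⟧ → a ∉ ⟦ v ⟧ → u ≢ v
  separated⇒≢ a∈u a∉u refl = a∉u a∈u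

  only-lost : Adj G u v → a ∈ ⟦ u ⟧ → a ∉ ⟦ v ⟧ → b ∈ ⟦ u ⟧ → b ≢ a → b ∈ ⟦ v ⟧
  only-lost {v = v} {b = b} u~v a∈u a∉v b∈u b≢a = decidable-stable (b ∈? ⟦ v ⟧) λ b∉v →
    b≢a (exchange-unique (meet-size u~v) b∈u b∉v a∈u a∉v)

  -- Both `u` and `v` keep the `k - 1` elements of `c` other than `a`.
  same-lost⇒adj : Adj G c u → Adj G c v → u ≢ v → a ∈ ⟦ c ⟧ → a ∉ ⟦ u ⟧ → a ∉ ⟦ v ⟧ → Adj G u v
  same-lost⇒adj {c} {u} {v} c~u c~v u≢v a∈c a∉u a∉v =
    adj⇐ u≢v (≤-trans (≤-reflexive (sym (adj⇒meet c~u))) (s≤s (p⊆q⇒∣p∣≤∣q∣ λ y∈ →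
      let y∈c , y∈u = x∈p∩q⁻ ⟦ c ⟧ ⟦ u ⟧ y∈
      in x∈p∩q⁺ (y∈u , only-lost c~v a∈c a∉v y∈c (∈∉⇒≢ y∈u a∉u)))))

  -- Of the `k - 1` elements in both `c` and `u`, at most one is missing from `v`, namely the one
  -- lost from `c` to `v`; the common gain `a`, outside `c`, makes up for it.
  same-gained⇒adj : Adj G c u → Adj G c v → u ≢ v → a ∉ ⟦ c ⟧ → a ∈ ⟦ u ⟧ → a ∈ ⟦ v ⟧ → Adj G u v
  same-gained⇒adj {c} {u} {v} c~u c~v u≢v a∉c a∈u a∈v =
    adj⇐ u≢v (begin
      k                                     ≡⟨ adj⇒meet c~u ⟨
      suc ∣ ⟦ c ⟧ ∩ ⟦ u ⟧ ∣                 ≤⟨ s≤s (∣p∣≤1+∣q∣ lost λ y∈ y≢ → x∈p∩q⁺ (y∈ ,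
                                                 only-lost c~v lost∈c lost∉v (p∩q⊆p _ _ y∈) y≢)) ⟩
      suc (suc ∣ (⟦ c ⟧ ∩ ⟦ u ⟧) ∩ ⟦ v ⟧ ∣) ≤⟨ s≤s (p⊂q⇒∣p∣<∣q∣ (c∩u∩v⊆u∩v , _ ,
                                                 x∈p∩q⁺ (a∈u , a∈v) , a∉c ∘ p∩q⊆p _ _ ∘ p∩q⊆p _ _)) ⟩
      suc ∣ ⟦ u ⟧ ∩ ⟦ v ⟧ ∣                 ∎)
    where
    open ≤-Reasoning
    loss = exchange (meet-size c~v)
    lost = proj₁ loss
    lost∈c = proj₁ (proj₂ loss)
    lost∉v = proj₂ (proj₂ loss)
    c∩u∩v⊆u∩v : (⟦ c ⟧ ∩ ⟦ u ⟧) ∩ ⟦ v ⟧ ⊆ ⟦ u ⟧ ∩ ⟦ v ⟧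
    c∩u∩v⊆u∩v y∈ = let y∈cu , y∈v = x∈p∩q⁻ (⟦ c ⟧ ∩ ⟦ u ⟧) ⟦ v ⟧ y∈
                   in x∈p∩q⁺ (p∩q⊆q ⟦ c ⟧ ⟦ u ⟧ y∈cu , y∈v)

  module IndependentNeighbours (f : Fin m → V) (c~f : ∀ i → Adj G c (f i))
    (f-inj : ∀ {i j} → f i ≡ f j → i ≡ j) (f≁f : ∀ i j → ¬ Adj G (f i) (f j)) where

    private
      loss : ∀ i → ∃[ x ] x ∈ ⟦ c ⟧ × x ∉ ⟦ f i ⟧
      loss i = exchange (meet-size (c~f i))

    lost : Fin m → Fin n
    lost i = proj₁ (loss i)

    lost∈ : ∀ i → lost i ∈ ⟦ c ⟧
    lost∈ i = proj₁ (proj₂ (loss i))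

    lost∉ : ∀ i → lost i ∉ ⟦ f i ⟧
    lost∉ i = proj₂ (proj₂ (loss i))

    lost-injective : ∀ {i j} → lost i ≡ lost j → i ≡ j
    lost-injective {i} {j} eq with i Fin.≟ j
    ... | yes i≡j = i≡j
    ... | no i≢j  = contradiction
      (same-lost⇒adj (c~f i) (c~f j) (i≢j ∘ f-inj) (lost∈ i) (lost∉ i)
        (subst (_∉ ⟦ f j ⟧) (sym eq) (lost∉ j)))
      (f≁f i j)

    count≤k : m ≤ k
    count≤k = subst (m ≤_) (size c) (injection⇒≤∣p∣ lost lost-injective lost∈)

  -- The element that `u` loses to `f i` is not in `v`: otherwise `u` and `v` would both gain it
  -- from `f i` and be adjacent. As `u` loses only one element to `f 0`, the elements lost to `f 1`
  -- and `f 2` are in `f 0`, so `f 0` would lose two elements to its neighbour `v`.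
  no-K₂₃ : u ≢ v → ¬ Adj G u v → (f : Fin 3 → V) → (∀ i → Adj G u (f i)) → (∀ i → Adj G v (f i)) →
    (∀ {i j} → f i ≡ f j → i ≡ j) → ¬ (∀ i j → ¬ Adj G (f i) (f j))
  no-K₂₃ {u} {v} u≢v u≁v f u~f v~f f-inj f≁f =
    contradiction (lost-injective (exchange-unique (meet-size f₀~v)
      (lost∈f₀ zero) (lost∉v (suc zero)) (lost∈f₀ (suc zero)) (lost∉v (suc (suc zero))))) λ ()
    where
    open IndependentNeighbours f u~f f-inj f≁f
    f₀~v : Adj G (f zero) v
    f₀~v = symm G (v~f zero)
    lost∉v : ∀ i → lost i ∉ ⟦ v ⟧
    lost∉v i lost∈v = u≁v (same-gained⇒adj (symm G (u~f i)) (symm G (v~f i)) u≢v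
      (lost∉ i) (lost∈ i) lost∈v)
    lost∈f₀ : ∀ i → lost (suc i) ∈ ⟦ f zero ⟧
    lost∈f₀ i = only-lost (u~f zero) (lost∈ zero) (lost∉ zero) (lost∈ (suc i))
      (Fin.0≢1+n ∘ sym ∘ lost-injective)

  module _ (u~v : Adj G u v) (a∈u : a ∈ ⟦ u ⟧) (a∉v : a ∉ ⟦ v ⟧) (b∈v : b ∈ ⟦ v ⟧) (b∉u : b ∉ ⟦ u ⟧) where

    -- If `c` contains `a` but not `b`, let `x` be the element that `u` loses to `c`. It differs
    -- from `a`, so `v` keeps it, and then `v` loses both `x` and `b` to `c`. Hence `x = b`,
    -- although `b` is not in `u`.
    common-neighbour : Adj G u c → Adj G v c → a ∈ ⟦ c ⟧ → b ∈ ⟦ c ⟧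
    common-neighbour {c} u~c v~c a∈c = decidable-stable (b ∈? ⟦ c ⟧) λ b∉c →
      let x , x∈u , x∉c = exchange (meet-size u~c)
          x∈v = only-lost u~v a∈u a∉v x∈u (≢-sym (∈∉⇒≢ a∈c x∉c))
      in b∉u (subst (_∈ ⟦ u ⟧) (exchange-unique (meet-size v~c) x∈v x∉c b∈v b∉c) x∈u)

    -- The two implications say that `c` and `d` agree on `a`, that is, are of the same kind. If
    -- both contain `a`, both gain `b` over `u`; if neither does, both lose `a`.
    common-neighbours⇒adj : Adj G u c → Adj G v c → Adj G u d → Adj G v d → c ≢ d →
      (a ∈ ⟦ c ⟧ → a ∈ ⟦ d ⟧) → (a ∈ ⟦ d ⟧ → a ∈ ⟦ c ⟧) → Adj G c d
    common-neighbours⇒adj {c = c} u~c v~c u~d v~d c≢d c→d d→c with a ∈? ⟦ c ⟧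
    ... | yes a∈c = same-gained⇒adj u~c u~d c≢d b∉u
      (common-neighbour u~c v~c a∈c) (common-neighbour u~d v~d (c→d a∈c))
    ... | no a∉c  = same-lost⇒adj u~c u~d c≢d a∈u a∉c (a∉c ∘ d→c)

    -- ⟦u⟧ ∪ ⟦v⟧ is a (k+1)-clique, as d witnesses that a and b are adjacent. Deleting from it
    -- any element shared by u, v and d leaves a k-clique other than those at u, v, c and d.
    another-vertex : 3 ≤ k → a ∉ ⟦ c ⟧ → Adj G u d → Adj G v d → a ∈ ⟦ d ⟧ →
      ∃[ e ] e ≢ u × e ≢ v × e ≢ c × e ≢ d
    another-vertex {c} {d} 3≤k a∉c u~d v~d a∈d =
      -- The shared element `t` is missing from `e` and separates it from `u`, `v` and `d`; `a` lies
      -- in `e` and separates it from `c`.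
      e , ≢-sym (separated⇒≢ t∈u t∉e) , ≢-sym (separated⇒≢ t∈v t∉e) , separated⇒≢ a∈e a∉c , ≢-sym (separated⇒≢ t∈d t∉e)
      where
      U : Subset n
      U = ⟦ u ⟧ ∪ ⁅ b ⁆

      b∈d : b ∈ ⟦ d ⟧
      b∈d = common-neighbour u~d v~d a∈d

      -- `u` and `v` share `k - 1` elements, at least two, and `d` misses at most one of them.
      shared : ∃[ t ] t ∈ (⟦ u ⟧ ∩ ⟦ v ⟧) ∩ ⟦ d ⟧
      shared with x , x∈u , x∉d ← exchange (meet-size u~d) =
        ∣p∣>0⇒nonempty ((⟦ u ⟧ ∩ ⟦ v ⟧) ∩ ⟦ d ⟧) (≤-pred (≤-pred (begin
          3                                     ≤⟨ 3≤k ⟩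
          k                                     ≡⟨ adj⇒meet u~v ⟨
          suc ∣ ⟦ u ⟧ ∩ ⟦ v ⟧ ∣                 ≤⟨ s≤s (∣p∣≤1+∣q∣ x λ y∈ y≢x → x∈p∩q⁺ (y∈ ,
                                                     only-lost u~d x∈u x∉d (p∩q⊆p _ _ y∈) y≢x)) ⟩
          suc (suc ∣ (⟦ u ⟧ ∩ ⟦ v ⟧) ∩ ⟦ d ⟧ ∣) ∎)))
        where open ≤-Reasoning

      t : Fin n
      t = proj₁ shared
      t∈u∩v : t ∈ ⟦ u ⟧ ∩ ⟦ v ⟧
      t∈u∩v = p∩q⊆p _ _ (proj₂ shared)
      t∈u : t ∈ ⟦ u ⟧
      t∈u = p∩q⊆p _ _ t∈u∩v
      t∈v : t ∈ ⟦ v ⟧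
      t∈v = p∩q⊆q ⟦ u ⟧ ⟦ v ⟧ t∈u∩v
      t∈d : t ∈ ⟦ d ⟧
      t∈d = p∩q⊆q (⟦ u ⟧ ∩ ⟦ v ⟧) ⟦ d ⟧ (proj₂ shared)

      u-b-adjacent : x ∈ ⟦ u ⟧ → Adj H x b
      u-b-adjacent {x} x∈u with x Fin.≟ a
      ... | yes refl = clique d a∈d b∈d (∈∉⇒≢ a∈u b∉u)
      ... | no x≢a   = clique v (only-lost u~v a∈u a∉v x∈u x≢a) b∈v (∈∉⇒≢ x∈u b∉u)

      U-clique : IsClique H U
      U-clique x∈ y∈ x≢y with x∈p∪q⁻ ⟦ u ⟧ ⁅ b ⁆ x∈ | x∈p∪q⁻ ⟦ u ⟧ ⁅ b ⁆ y∈
      ... | inj₁ x∈u | inj₁ y∈u = clique u x∈u y∈u x≢y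
      ... | inj₁ x∈u | inj₂ y∈b rewrite x∈⁅y⁆⇒x≡y b y∈b = u-b-adjacent x∈u
      ... | inj₂ x∈b | inj₁ y∈u rewrite x∈⁅y⁆⇒x≡y b x∈b = symm H (u-b-adjacent y∈u)
      ... | inj₂ x∈b | inj₂ y∈b =
        contradiction (trans (x∈⁅y⁆⇒x≡y b x∈b) (sym (x∈⁅y⁆⇒x≡y b y∈b))) x≢y

      U-size : ∣ U ∣ ≡ suc k
      U-size = trans (∣p∪⁅x⁆∣≡1+∣p∣ ⟦ u ⟧ b∉u) (cong suc (size u))

      new : ∃[ e ] ⟦ e ⟧ ≡ U - t
      new = surjective (U - t) (λ x∈ y∈ → U-clique (p─q⊆p U ⁅ t ⁆ x∈) (p─q⊆p U ⁅ t ⁆ y∈))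
        (suc-injective (trans (1+∣p-x∣≡∣p∣ U (p⊆p∪q ⁅ b ⁆ t∈u)) U-size))

      e : V
      e = proj₁ new
      t∉e : t ∉ ⟦ e ⟧
      t∉e = x∉p-x U t ∘ subst (t ∈_) (proj₂ new)
      a∈e : a ∈ ⟦ e ⟧
      a∈e = subst (a ∈_) (sym (proj₂ new))
        (x∈p∧x≢y⇒x∈p-y (p⊆p∪q ⁅ b ⁆ a∈u) (≢-sym (∈∉⇒≢ t∈v a∉v)))

-- Host graphs

⁅⁆-injective : ⁅ x ⁆ ≡ ⁅ y ⁆ → x ≡ y
⁅⁆-injective {x = x} {y = y} eq = x∈⁅y⁆⇒x≡y y (subst (x ∈_) eq (x∈⁅x⁆ x))

¬1+∣p∩p∣≡∣p∣ : ∀ (P : Subset n) → suc ∣ P ∩ P ∣ ≢ ∣ P ∣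
¬1+∣p∩p∣≡∣p∣ P eq = 1+n≢n (trans (cong (suc ∘ ∣_∣) (sym (∩-idem P))) eq)

∣p∣>1⇒distinct : ∀ (P : Subset n) → 1 < ∣ P ∣ → ∃[ x ] ∃[ y ] x ≢ y × x ∈ P × y ∈ P
∣p∣>1⇒distinct P 1<∣P∣ with x , x∈P ← ∣p∣>0⇒nonempty P (<-trans (s≤s z≤n) 1<∣P∣)
  with y , y∈ ← ∣p∣>0⇒nonempty (P - x) (≤-pred (≤-trans 1<∣P∣ (≤-reflexive (sym (1+∣p-x∣≡∣p∣ P x∈P))))) =
  x , y , ≢-sym (y∈p-x⇒y≢x P y∈) , x∈P , p─q⊆p P ⁅ x ⁆ y∈

edgeless-tight : Tight (Edgeless n) 1
edgeless-tight S c ∣S∣≡2 with _ , _ , x≢y , x∈S , y∈S ← ∣p∣>1⇒distinct S (≤-reflexive (sym ∣S∣≡2)) = c x∈S y∈S x≢y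

-- The 1-cliques of an edgeless graph are the singletons, and distinct ones meet in `k - 1 = 0`
-- elements.
complete-representation : {G : SimpleGraph V} → V ↔ Fin n → (∀ u v → u ≢ v → Adj G u v) →
  Representation G 1 (Edgeless n)
complete-representation {V = V} {n = n} {G = G} V↔Fin complete = record
  { ⟦_⟧        = ⟦_⟧
  ; clique     = λ v {x} {y} x∈ y∈ x≢y → x≢y (trans (x∈⁅y⁆⇒x≡y (to v) x∈) (sym (x∈⁅y⁆⇒x≡y (to v) y∈)))
  ; size       = λ v → ∣⁅x⁆∣≡1 (to v)
  ; injective  = injective
  ; surjective = λ S _ ∣S∣≡1 → let x , S≡ = ∣p∣≡1⇒singleton S ∣S∣≡1 in
      from x , trans (cong ⁅_⁆ (strictlyInverseˡ x)) (sym S≡)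
  ; adj⇒meet   = λ {u} {v} u~v → meet⇐ {P = ⟦ u ⟧} (∣⁅x⁆∣≡1 (to u)) (∣⁅x⁆∣≡1 (to v))
      (λ eq → irrefl G (injective eq) u~v) (s≤s z≤n)
  ; meet⇒adj   = λ {u} {v} meet → complete u v λ { refl →
      ¬1+∣p∩p∣≡∣p∣ ⟦ u ⟧ (trans meet (sym (∣⁅x⁆∣≡1 (to u)))) }
  }
  where
  open Inverse V↔Fin
  ⟦_⟧ : V → Subset n
  ⟦ v ⟧ = ⁅ to v ⁆
  injective : ∀ {u v} → ⟦ u ⟧ ≡ ⟦ v ⟧ → u ≡ v
  injective {u} {v} eq =
    trans (sym (strictlyInverseʳ u)) (trans (cong from (⁅⁆-injective eq)) (strictlyInverseʳ v))

𝒦-complete : {G : SimpleGraph V} → V ↔ Fin n → (∀ u v → u ≢ v → Adj G u v) → 𝒦 G ≐ (1 ≤_)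
𝒦-complete V↔Fin complete =
  proj₁ , λ 1≤k → tight⇒𝒦-upward ≤-refl (complete-representation V↔Fin complete) edgeless-tight 1≤k

-- Subsets of a disjoint union as concatenations

∣p++q∣≡∣p∣+∣q∣ : ∀ (P : Subset m) (Q : Subset n) → ∣ P ++ Q ∣ ≡ ∣ P ∣ + ∣ Q ∣
∣p++q∣≡∣p∣+∣q∣ []            Q = refl
∣p++q∣≡∣p∣+∣q∣ (inside  ∷ P) Q = cong suc (∣p++q∣≡∣p∣+∣q∣ P Q)
∣p++q∣≡∣p∣+∣q∣ (outside ∷ P) Q = ∣p++q∣≡∣p∣+∣q∣ P Q

↑ˡ∈++⁺ : ∀ {P : Subset m} {Q : Subset n} {i} → i ∈ P → i ↑ˡ n ∈ P ++ Q
↑ˡ∈++⁺ {P = P} {Q} {i} i∈ = lookup⇒[]= _ _ (trans (lookup-++ˡ P Q i) ([]=⇒lookup i∈))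

↑ˡ∈++⁻ : ∀ (P : Subset m) (Q : Subset n) {i} → i ↑ˡ n ∈ P ++ Q → i ∈ P
↑ˡ∈++⁻ P Q {i} i∈ = lookup⇒[]= _ _ (trans (sym (lookup-++ˡ P Q i)) ([]=⇒lookup i∈))

↑ʳ∈++⁺ : ∀ {P : Subset m} {Q : Subset n} {j} → j ∈ Q → m ↑ʳ j ∈ P ++ Q
↑ʳ∈++⁺ {P = P} {Q} {j} j∈ = lookup⇒[]= _ _ (trans (lookup-++ʳ P Q j) ([]=⇒lookup j∈))

↑ʳ∈++⁻ : ∀ (P : Subset m) (Q : Subset n) {j} → m ↑ʳ j ∈ P ++ Q → j ∈ Q
↑ʳ∈++⁻ P Q {j} j∈ = lookup⇒[]= _ _ (trans (sym (lookup-++ʳ P Q j)) ([]=⇒lookup j∈))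

↑ˡ≢↑ʳ : ∀ (i : Fin m) (j : Fin n) → i ↑ˡ n ≢ m ↑ʳ j
↑ˡ≢↑ʳ {m} {n} i j eq
  with () ← trans (sym (Fin.splitAt-↑ˡ m i n)) (trans (cong (splitAt m) eq) (Fin.splitAt-↑ʳ m n j))

++-mono-except : ∀ (A A′ : Subset m) (B B′ : Subset n) {j} →
  (∀ {i} → i ∈ A → i ∈ A′) → (∀ {i} → i ∈ B → i ≢ j → i ∈ B′) →
  ∀ {x} → x ∈ A ++ B → x ≢ m ↑ʳ j → x ∈ A′ ++ B′
++-mono-except {m} {n} A A′ B B′ A⊆ B⊆ {x} x∈ x≢ = go (splitAt m x) (Fin.join-splitAt m n x)
  where
  go : ∀ u → join m n u ≡ x → x ∈ A′ ++ B′
  go (inj₁ i) refl = ↑ˡ∈++⁺ (A⊆ (↑ˡ∈++⁻ A B x∈))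
  go (inj₂ i) refl = ↑ʳ∈++⁺ {P = A′} (B⊆ (↑ʳ∈++⁻ A B x∈) (x≢ ∘ cong (m ↑ʳ_)))

-- The complete graph on the hub Fin p together with independent tips, the tip j being
-- adjacent to every hub vertex except g j. Its p-cliques are the hub and the sets obtained
-- from the hub by exchanging g j for the tip j.
module Windmill {p q : ℕ} (g : Fin q → Fin p) where

  SunAdj : Fin p ⊎ Fin q → Fin p ⊎ Fin q → Set
  SunAdj (inj₁ i) (inj₁ j) = i ≢ j
  SunAdj (inj₁ i) (inj₂ j) = i ≢ g j
  SunAdj (inj₂ i) (inj₁ j) = j ≢ g i
  SunAdj (inj₂ _) (inj₂ _) = Data.Empty.⊥

  sunAdj? : ∀ u v → Dec (SunAdj u v)
  sunAdj? (inj₁ i) (inj₁ j) = ¬? (i Fin.≟ j)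
  sunAdj? (inj₁ i) (inj₂ j) = ¬? (i Fin.≟ g j)
  sunAdj? (inj₂ i) (inj₁ j) = ¬? (j Fin.≟ g i)
  sunAdj? (inj₂ _) (inj₂ _) = no λ ()

  sunAdj-sym : ∀ u v → SunAdj u v → SunAdj v u
  sunAdj-sym (inj₁ _) (inj₁ _) e = ≢-sym e
  sunAdj-sym (inj₁ _) (inj₂ _) e = e
  sunAdj-sym (inj₂ _) (inj₁ _) e = e

  sunAdj-irrefl : ∀ u → ¬ SunAdj u u
  sunAdj-irrefl (inj₁ _) e = e refl

  Sun : SimpleGraph (Fin (p + q))
  Sun = record
    { Adj    = λ x y → SunAdj (splitAt p x) (splitAt p y)
    ; adj?   = λ x y → sunAdj? (splitAt p x) (splitAt p y)
    ; symm   = λ {x} {y} → sunAdj-sym (splitAt p x) (splitAt p y)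
    ; irrefl = λ { {x} refl → sunAdj-irrefl (splitAt p x) }
    }

  sun-adj⁻ : ∀ u v → Adj Sun (join p q u) (join p q v) → SunAdj u v
  sun-adj⁻ u v = subst₂ SunAdj (Fin.splitAt-join p q u) (Fin.splitAt-join p q v)

  module _ {A : Subset p} {B : Subset q} where

    sun-clique⁺ : (∀ {i j} → i ∈ B → j ∈ B → i ≡ j) → (∀ {i j} → i ∈ A → j ∈ B → i ≢ g j) →
      IsClique Sun (A ++ B)
    sun-clique⁺ B-single A-misses {x} {y} x∈ y∈ x≢y =
      go (splitAt p x) (splitAt p y) (Fin.join-splitAt p q x) (Fin.join-splitAt p q y)
      where
      go : ∀ u v → join p q u ≡ x → join p q v ≡ y → SunAdj u v
      go (inj₁ i) (inj₁ j) refl refl = λ { refl → x≢y refl }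
      go (inj₁ i) (inj₂ j) refl refl = A-misses (↑ˡ∈++⁻ A B x∈) (↑ʳ∈++⁻ A B y∈)
      go (inj₂ i) (inj₁ j) refl refl = A-misses (↑ˡ∈++⁻ A B y∈) (↑ʳ∈++⁻ A B x∈)
      go (inj₂ i) (inj₂ j) refl refl =
        x≢y (cong (p ↑ʳ_) (B-single (↑ʳ∈++⁻ A B x∈) (↑ʳ∈++⁻ A B y∈)))

    sun-clique⁻-tips : IsClique Sun (A ++ B) → ∀ {i j} → i ∈ B → j ∈ B → i ≡ j
    sun-clique⁻-tips c {i} {j} i∈ j∈ = decidable-stable (i Fin.≟ j) λ i≢j →
      sun-adj⁻ (inj₂ i) (inj₂ j) (c (↑ʳ∈++⁺ i∈) (↑ʳ∈++⁺ j∈) (i≢j ∘ Fin.↑ʳ-injective p i j))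

    sun-clique⁻-hub : IsClique Sun (A ++ B) → ∀ {i j} → i ∈ A → j ∈ B → i ≢ g j
    sun-clique⁻-hub c {i} {j} i∈ j∈ =
      sun-adj⁻ (inj₁ i) (inj₂ j) (c (↑ˡ∈++⁺ i∈) (↑ʳ∈++⁺ j∈) (↑ˡ≢↑ʳ i j))

    -- The tips are independent, so a clique has at most one tip `j`, and then misses the hub vertex
    -- `g j`.
    sun-clique-shape : IsClique Sun (A ++ B) →
      B ≡ ⊥ ⊎ ∃[ j ] B ≡ ⁅ j ⁆ × A ⊆ ⊤ - g j
    sun-clique-shape c with nonempty? B
    ... | no ¬ne      = inj₁ (Empty-unique ¬ne)
    ... | yes (j , j∈) = inj₂ (j ,
      ⊆-antisym (λ {i} i∈ → subst (_∈ ⁅ j ⁆) (sun-clique⁻-tips c j∈ i∈) (x∈⁅x⁆ j))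
                (λ i∈ → subst (_∈ B) (sym (x∈⁅y⁆⇒x≡y j i∈)) j∈) ,
      λ i∈ → x∈p∧x≢y⇒x∈p-y ∈⊤ (sun-clique⁻-hub c i∈ j∈))

  sun-tight : Tight Sun p
  sun-tight S c ∣S∣≡1+p with A , B , refl ← Vec.splitAt p S
    with sun-clique-shape {A} {B} c | trans (sym (∣p++q∣≡∣p∣+∣q∣ A B)) ∣S∣≡1+p
  ... | inj₁ refl             | eq = 1+n≰n (subst (_≤ p) (trans (sym (+-identityʳ _))
    (trans (cong (∣ A ∣ +_) (sym (∣⊥∣≡0 q))) eq)) (∣p∣≤n A))
  ... | inj₂ (j , refl , A⊆) | eq = 1+n≰n (begin-strict
      p            ≡⟨ suc-injective (trans (sym (trans (cong (∣ A ∣ +_) (∣⁅x⁆∣≡1 j)) (+-comm _ 1))) eq) ⟨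
      ∣ A ∣        ≤⟨ p⊆q⇒∣p∣≤∣q∣ A⊆ ⟩
      ∣ ⊤ - g j ∣  <⟨ x∈p⇒∣p-x∣<∣p∣ {x = g j} {p = ⊤ {p}} ∈⊤ ⟩
      ∣ ⊤ {p} ∣    ≡⟨ ∣⊤∣≡n p ⟩
      p            ∎)
    where open ≤-Reasoning

-- Here `f w` is the hub vertex that the tip of `w` replaces, and the centre `inj₁ zero` stands for
-- the whole hub.
module _ {W : Set} {p q : ℕ} {G : SimpleGraph (Fin 1 ⊎ W)} (W↔Fin : W ↔ Fin q) (f : W → Fin p)
  (hub~tip : ∀ w → Adj G (inj₁ zero) (inj₂ w))
  (tip~tip : ∀ w x → Adj G (inj₂ w) (inj₂ x) ⇔ (w ≢ x × f w ≡ f x)) where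

  open Inverse W↔Fin
  open Windmill (f ∘ from)

  private
    ⟦_⟧ : Fin 1 ⊎ W → Subset (p + q)
    ⟦ inj₁ _ ⟧ = ⊤ {p} ++ ⊥ {q}
    ⟦ inj₂ w ⟧ = (⊤ - f w) ++ ⁅ to w ⁆

    to-injective : ∀ {w x} → to w ≡ to x → w ≡ x
    to-injective eq = trans (sym (strictlyInverseʳ _)) (trans (cong from eq) (strictlyInverseʳ _))

    clique : ∀ v → IsClique Sun ⟦ v ⟧
    clique (inj₁ _) = sun-clique⁺ (λ i∈ → contradiction i∈ ∉⊥) (λ _ j∈ → contradiction j∈ ∉⊥)
    clique (inj₂ w) = sun-clique⁺
      (λ i∈ j∈ → trans (x∈⁅y⁆⇒x≡y _ i∈) (sym (x∈⁅y⁆⇒x≡y _ j∈)))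
      (λ { {i} {j} i∈ j∈ i≡ → y∈p-x⇒y≢x ⊤ i∈
        (trans i≡ (trans (cong (f ∘ from) (x∈⁅y⁆⇒x≡y _ j∈)) (cong f (strictlyInverseʳ w)))) })

    1+∣⊤-x∣≡p : ∀ x → suc ∣ ⊤ {p} - x ∣ ≡ p
    1+∣⊤-x∣≡p x = trans (1+∣p-x∣≡∣p∣ {x = x} (⊤ {p}) ∈⊤) (∣⊤∣≡n p)

    ∣p++⊥∣≡∣p∣ : ∀ (A : Subset p) → ∣ A ++ ⊥ {q} ∣ ≡ ∣ A ∣
    ∣p++⊥∣≡∣p∣ A = trans (∣p++q∣≡∣p∣+∣q∣ A ⊥) (trans (cong (∣ A ∣ +_) (∣⊥∣≡0 q)) (+-identityʳ _))

    ∣p++⁅x⁆∣≡1+∣p∣ : ∀ (A : Subset p) (j : Fin q) → ∣ A ++ ⁅ j ⁆ ∣ ≡ suc ∣ A ∣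
    ∣p++⁅x⁆∣≡1+∣p∣ A j = trans (∣p++q∣≡∣p∣+∣q∣ A ⁅ j ⁆) (trans (cong (∣ A ∣ +_) (∣⁅x⁆∣≡1 j)) (+-comm _ 1))

    size : ∀ v → ∣ ⟦ v ⟧ ∣ ≡ p
    size (inj₁ _) = trans (∣p++⊥∣≡∣p∣ (⊤ {p})) (∣⊤∣≡n p)
    size (inj₂ w) = trans (∣p++⁅x⁆∣≡1+∣p∣ (⊤ - f w) (to w)) (1+∣⊤-x∣≡p (f w))

    hub≢tip : ∀ w → ⟦ inj₁ zero ⟧ ≢ ⟦ inj₂ w ⟧
    hub≢tip w eq = ∉⊥ (subst (to w ∈_) (sym (++-injectiveʳ (⊤ {p}) (⊤ - f w) eq)) (x∈⁅x⁆ (to w)))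

    injective : ∀ {u v} → ⟦ u ⟧ ≡ ⟦ v ⟧ → u ≡ v
    injective {inj₁ zero} {inj₁ zero} _  = refl
    injective {inj₁ zero} {inj₂ w}    eq = contradiction eq (hub≢tip w)
    injective {inj₂ w}    {inj₁ zero} eq = contradiction (sym eq) (hub≢tip w)
    injective {inj₂ w}    {inj₂ x}    eq =
      cong inj₂ (to-injective (⁅⁆-injective (++-injectiveʳ (⊤ - f w) (⊤ - f x) eq)))

    surjective : ∀ S → IsClique Sun S → ∣ S ∣ ≡ p → ∃[ v ] ⟦ v ⟧ ≡ S
    surjective S c ∣S∣≡p with A , B , refl ← Vec.splitAt p S with sun-clique-shape {A} {B} c
    ... | inj₁ refl            = inj₁ zero ,
      cong (_++ ⊥) (sym (∣p∣≡n⇒p≡⊤ {p = A} (trans (sym (∣p++⊥∣≡∣p∣ A)) ∣S∣≡p)))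
    ... | inj₂ (j , refl , A⊆) = inj₂ (from j) ,
      cong₂ _++_ (sym (∣p∣≥∣q∣⇒p≡q A⊆ (≤-reflexive (suc-injective (trans (1+∣⊤-x∣≡p (f (from j)))
                   (trans (sym ∣S∣≡p) (∣p++⁅x⁆∣≡1+∣p∣ A j)))))))
                 (cong ⁅_⁆ (strictlyInverseˡ j))

    tip-meets-hub : ∀ w → suc ∣ ⟦ inj₂ w ⟧ ∩ ⟦ inj₁ zero ⟧ ∣ ≡ p
    tip-meets-hub w = meet⇐lost (p ↑ʳ to w) (size (inj₂ w)) (size (inj₁ zero)) (≢-sym (hub≢tip w))
      (++-mono-except (⊤ - f w) ⊤ ⁅ to w ⁆ ⊥ (λ _ → ∈⊤) λ j∈ j≢ → contradiction (x∈⁅y⁆⇒x≡y _ j∈) j≢)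

    adj⇒meet : ∀ {u v} → Adj G u v → suc ∣ ⟦ u ⟧ ∩ ⟦ v ⟧ ∣ ≡ p
    adj⇒meet {inj₁ zero} {inj₁ zero} u~v = contradiction u~v (irrefl G refl)
    adj⇒meet {inj₁ zero} {inj₂ w}    _   = trans (cong (suc ∘ ∣_∣) (∩-comm (⊤ {p} ++ ⊥) ⟦ inj₂ w ⟧)) (tip-meets-hub w)
    adj⇒meet {inj₂ w}    {inj₁ zero} _   = tip-meets-hub w
    adj⇒meet {inj₂ w}    {inj₂ x}    u~v =
      let w≢x , fw≡fx = Equivalence.to (tip~tip w x) u~v in
      meet⇐lost (p ↑ʳ to w) (size (inj₂ w)) (size (inj₂ x)) (λ eq → w≢x (inj₂-injective (injective eq)))
        (++-mono-except (⊤ - f w) (⊤ - f x) ⁅ to w ⁆ ⁅ to x ⁆ (λ {i} → subst (λ y → i ∈ ⊤ - y) fw≡fx)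
                        (λ j∈ j≢ → contradiction (x∈⁅y⁆⇒x≡y _ j∈) j≢))

    meet⇒adj : ∀ {u v} → suc ∣ ⟦ u ⟧ ∩ ⟦ v ⟧ ∣ ≡ p → Adj G u v
    meet⇒adj {inj₁ zero} {inj₁ zero} meet =
      contradiction (trans meet (sym (size (inj₁ zero)))) (¬1+∣p∩p∣≡∣p∣ ⟦ inj₁ zero ⟧)
    meet⇒adj {inj₁ zero} {inj₂ w}    _    = hub~tip w
    meet⇒adj {inj₂ w}    {inj₁ zero} _    = symm G (hub~tip w)
    meet⇒adj {inj₂ w}    {inj₂ x}    meet = Equivalence.from (tip~tip w x) (w≢x , fw≡fx)
      where
      meet′ : suc ∣ ⟦ inj₂ w ⟧ ∩ ⟦ inj₂ x ⟧ ∣ ≡ ∣ ⟦ inj₂ w ⟧ ∣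
      meet′ = trans meet (sym (size (inj₂ w)))
      w≢x : w ≢ x
      w≢x refl = ¬1+∣p∩p∣≡∣p∣ ⟦ inj₂ w ⟧ meet′
      fw≡fx : f w ≡ f x
      -- If `f w` and `f x` differed, the clique of `w` would have two elements outside that of `x`:
      -- the hub vertex `f x` and the tip of `w`.
      fw≡fx = decidable-stable (f w Fin.≟ f x) λ fw≢fx → ↑ˡ≢↑ʳ (f x) (to w) (exchange-unique meet′
        (↑ˡ∈++⁺ (x∈p∧x≢y⇒x∈p-y ∈⊤ (≢-sym fw≢fx))) (x∉p-x ⊤ (f x) ∘ ↑ˡ∈++⁻ (⊤ - f x) ⁅ to x ⁆)
        (↑ʳ∈++⁺ {P = ⊤ - f w} (x∈⁅x⁆ (to w)))
        (λ ∈x → w≢x (to-injective (x∈⁅y⁆⇒x≡y _ (↑ʳ∈++⁻ (⊤ - f x) ⁅ to x ⁆ ∈x)))))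

  windmill-representation : Representation G p Sun
  windmill-representation = record
    { ⟦_⟧        = ⟦_⟧
    ; clique     = clique
    ; size       = size
    ; injective  = injective
    ; surjective = surjective
    ; adj⇒meet   = adj⇒meet
    ; meet⇒adj   = meet⇒adj
    }

  windmill⇒𝒦-upward : 1 ≤ p → p ≤ k → 𝒦 G k
  windmill⇒𝒦-upward 1≤p = tight⇒𝒦-upward 1≤p windmill-representation sun-tight

-- A graph with edges s i — t i whose orientation from s i to t i is injective on sources and on
-- targets and has no directed cycle of length at most three: it is triangle-free, and its line
-- graph joins i and j exactly when one of the edges starts where the other ends.
module LineGraph {m n : ℕ} (s t : Fin m → Fin n)
  (s-injective : ∀ {i j} → s i ≡ s j → i ≡ j) (t-injective : ∀ {i j} → t i ≡ t j → i ≡ j)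
  (no-2-cycle : ∀ i j → t i ≡ s j → t j ≢ s i)
  (no-3-cycle : ∀ i j l → t i ≡ s j → t j ≡ s l → t l ≢ s i) where

  Joins : Fin m → Fin n → Fin n → Set
  Joins i x y = (x ≡ s i × y ≡ t i) ⊎ (x ≡ t i × y ≡ s i)

  s≢t : ∀ i → s i ≢ t i
  -- A loop is the case `i = j` of a directed 2-cycle.
  s≢t i eq = no-2-cycle i i (sym eq) (sym eq)

  Host : SimpleGraph (Fin n)
  Host = record
    { Adj    = λ x y → ∃[ i ] Joins i x y
    ; adj?   = λ x y → Fin.any? λ i →
        (x Fin.≟ s i ×-dec y Fin.≟ t i) ⊎-dec (x Fin.≟ t i ×-dec y Fin.≟ s i)
    ; symm   = λ { (i , inj₁ (x≡ , y≡)) → i , inj₂ (y≡ , x≡)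
                 ; (i , inj₂ (x≡ , y≡)) → i , inj₁ (y≡ , x≡) }
    ; irrefl = λ { refl (i , inj₁ (x≡ , y≡)) → s≢t i (trans (sym x≡) y≡)
                 ; refl (i , inj₂ (x≡ , y≡)) → s≢t i (trans (sym y≡) x≡) }
    }

  edge : Fin m → Subset n
  edge i = ⁅ s i ⁆ ∪ ⁅ t i ⁆

  s∈edge : ∀ i → s i ∈ edge i
  s∈edge i = x∈p∪q⁺ (inj₁ (x∈⁅x⁆ (s i)))

  t∈edge : ∀ i → t i ∈ edge i
  t∈edge i = x∈p∪q⁺ (inj₂ (x∈⁅x⁆ (t i)))

  ∈edge⁻ : ∀ {i x} → x ∈ edge i → x ≡ s i ⊎ x ≡ t i
  ∈edge⁻ {i} x∈ = Sum.map (x∈⁅y⁆⇒x≡y _) (x∈⁅y⁆⇒x≡y _) (x∈p∪q⁻ ⁅ s i ⁆ ⁅ t i ⁆ x∈)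

  edge-clique : ∀ i → IsClique Host (edge i)
  edge-clique i x∈ y∈ x≢y with ∈edge⁻ x∈ | ∈edge⁻ y∈
  ... | inj₁ x≡ | inj₁ y≡ = contradiction (trans x≡ (sym y≡)) x≢y
  ... | inj₁ x≡ | inj₂ y≡ = i , inj₁ (x≡ , y≡)
  ... | inj₂ x≡ | inj₁ y≡ = i , inj₂ (x≡ , y≡)
  ... | inj₂ x≡ | inj₂ y≡ = contradiction (trans x≡ (sym y≡)) x≢y

  ∣edge∣≡2 : ∀ i → ∣ edge i ∣ ≡ 2
  ∣edge∣≡2 i = trans (∣p∪⁅x⁆∣≡1+∣p∣ ⁅ s i ⁆ (x≢y⇒x∉⁅y⁆ (≢-sym (s≢t i)))) (cong suc (∣⁅x⁆∣≡1 (s i)))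

  edge-injective : ∀ {i j} → edge i ≡ edge j → i ≡ j
  edge-injective {i} {j} eq
    with ∈edge⁻ {j} (subst (s i ∈_) eq (s∈edge i)) | ∈edge⁻ {j} (subst (t i ∈_) eq (t∈edge i))
  ... | inj₁ s≡s | _        = s-injective s≡s
  ... | inj₂ _   | inj₂ t≡t = t-injective t≡t
  ... | inj₂ s≡t | inj₁ t≡s = contradiction (sym s≡t) (no-2-cycle i j t≡s)

  edge-surjective : ∀ S → IsClique Host S → ∣ S ∣ ≡ 2 → ∃[ i ] edge i ≡ S
  edge-surjective S c ∣S∣≡2
    with x , y , x≢y , x∈S , y∈S ← ∣p∣>1⇒distinct S (≤-reflexive (sym ∣S∣≡2))
    with i , joins ← c x∈S y∈S x≢y =
    i , ∣p∣≥∣q∣⇒p≡q {P = edge i} (λ z∈ → edge⊆S joins (∈edge⁻ z∈)) (≤-reflexive (trans ∣S∣≡2 (sym (∣edge∣≡2 i))))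
    where
    edge⊆S : Joins i x y → ∀ {z} → z ≡ s i ⊎ z ≡ t i → z ∈ S
    edge⊆S (inj₁ (refl , refl)) (inj₁ refl) = x∈S
    edge⊆S (inj₁ (refl , refl)) (inj₂ refl) = y∈S
    edge⊆S (inj₂ (refl , refl)) (inj₁ refl) = y∈S
    edge⊆S (inj₂ (refl , refl)) (inj₂ refl) = x∈S

  -- A triangle is either a directed 3-cycle, or some corner is the source or the target of two of
  -- its sides. In the latter case injectivity identifies these two sides and hence two of the
  -- corners.
  no-triangle : ∀ {x y z i j l} → x ≢ y → y ≢ z → x ≢ z → Joins i x y → Joins j y z → ¬ Joins l x z
  no-triangle x≢y y≢z x≢z (inj₁ (x≡s , y≡t)) (inj₁ (y≡s , z≡t)) (inj₁ (x≡s′ , z≡t′)) =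
    y≢z (trans y≡t (trans (cong t (s-injective (trans (sym x≡s) x≡s′))) (sym z≡t′)))
  no-triangle x≢y y≢z x≢z (inj₁ (x≡s , y≡t)) (inj₁ (y≡s , z≡t)) (inj₂ (x≡t′ , z≡s′)) =
    no-3-cycle _ _ _ (trans (sym y≡t) y≡s) (trans (sym z≡t) z≡s′) (trans (sym x≡t′) x≡s)
  no-triangle x≢y y≢z x≢z (inj₁ (x≡s , y≡t)) (inj₂ (y≡t′ , z≡s)) _ =
    x≢z (trans x≡s (trans (cong s (t-injective (trans (sym y≡t) y≡t′))) (sym z≡s)))
  no-triangle x≢y y≢z x≢z (inj₂ (x≡t , y≡s)) (inj₁ (y≡s′ , z≡t)) _ =
    x≢z (trans x≡t (trans (cong t (s-injective (trans (sym y≡s) y≡s′))) (sym z≡t)))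
  no-triangle x≢y y≢z x≢z (inj₂ (x≡t , y≡s)) (inj₂ (y≡t , z≡s)) (inj₁ (x≡s , z≡t)) =
    no-3-cycle _ _ _ (trans (sym x≡t) x≡s) (trans (sym z≡t) z≡s) (trans (sym y≡t) y≡s)
  no-triangle x≢y y≢z x≢z (inj₂ (x≡t , y≡s)) (inj₂ (y≡t , z≡s)) (inj₂ (x≡t′ , z≡s′)) =
    y≢z (trans y≡s (trans (cong s (t-injective (trans (sym x≡t) x≡t′))) (sym z≡s′)))

  host-tight : Tight Host 2
  host-tight S c ∣S∣≡3
    with x , x∈S ← ∣p∣>0⇒nonempty S (subst (0 <_) (sym ∣S∣≡3) (s≤s z≤n))
    with y , z , y≢z , y∈ , z∈ ← ∣p∣>1⇒distinct (S - x)
      (≤-reflexive (suc-injective (trans (sym ∣S∣≡3) (sym (1+∣p-x∣≡∣p∣ S x∈S))))) =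
    no-triangle x≢y y≢z x≢z (proj₂ (c x∈S y∈S x≢y)) (proj₂ (c y∈S z∈S y≢z)) (proj₂ (c x∈S z∈S x≢z))
    where
    y∈S = p─q⊆p S ⁅ x ⁆ y∈
    z∈S = p─q⊆p S ⁅ x ⁆ z∈
    x≢y = ≢-sym (y∈p-x⇒y≢x S y∈)
    x≢z = ≢-sym (y∈p-x⇒y≢x S z∈)

  module _ {G : SimpleGraph (Fin m)} (adj⇔ : ∀ i j → Adj G i j ⇔ (t i ≡ s j ⊎ t j ≡ s i)) where

    edge-adj⇒meet : ∀ {i j} → Adj G i j → suc ∣ edge i ∩ edge j ∣ ≡ 2
    edge-adj⇒meet {i} {j} i~j = meet⇐ {P = edge i} (∣edge∣≡2 i) (∣edge∣≡2 j)
      (λ eq → irrefl G (edge-injective eq) i~j) (s≤s (meet (Equivalence.to (adj⇔ i j) i~j)))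
      where
      shared⇒meet : ∀ {x} → x ∈ edge i → x ∈ edge j → 1 ≤ ∣ edge i ∩ edge j ∣
      shared⇒meet x∈i x∈j =
        ≤-trans (s≤s z≤n) (x∈p⇒∣p-x∣<∣p∣ {p = edge i ∩ edge j} (x∈p∩q⁺ (x∈i , x∈j)))
      meet : t i ≡ s j ⊎ t j ≡ s i → 1 ≤ ∣ edge i ∩ edge j ∣
      meet (inj₁ ti≡sj) = shared⇒meet (t∈edge i) (subst (_∈ edge j) (sym ti≡sj) (s∈edge j))
      meet (inj₂ tj≡si) = shared⇒meet (subst (_∈ edge i) (sym tj≡si) (s∈edge i)) (t∈edge j)

    -- Two distinct edges share neither sources nor targets, so a vertex common to both is the
    -- target of one and the source of the other.
    edge-meet⇒adj : ∀ {i j} → suc ∣ edge i ∩ edge j ∣ ≡ 2 → Adj G i j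
    edge-meet⇒adj {i} {j} meet
      with x , x∈ ← ∣p∣>0⇒nonempty (edge i ∩ edge j) (≤-reflexive (suc-injective (sym meet)))
      with ∈edge⁻ (proj₁ (x∈p∩q⁻ (edge i) (edge j) x∈)) | ∈edge⁻ (proj₂ (x∈p∩q⁻ (edge i) (edge j) x∈))
    ... | inj₁ x≡s | inj₁ x≡s′ = contradiction (s-injective (trans (sym x≡s) x≡s′)) i≢j
      where
      i≢j : i ≢ j
      i≢j refl = ¬1+∣p∩p∣≡∣p∣ (edge i) (trans meet (sym (∣edge∣≡2 i)))
    ... | inj₂ x≡t | inj₁ x≡s  = Equivalence.from (adj⇔ i j) (inj₁ (trans (sym x≡t) x≡s))
    ... | inj₁ x≡s | inj₂ x≡t  = Equivalence.from (adj⇔ i j) (inj₂ (trans (sym x≡t) x≡s))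
    ... | inj₂ x≡t | inj₂ x≡t′ = contradiction (t-injective (trans (sym x≡t) x≡t′)) i≢j
      where
      i≢j : i ≢ j
      i≢j refl = ¬1+∣p∩p∣≡∣p∣ (edge i) (trans meet (sym (∣edge∣≡2 i)))

    line-representation : Representation G 2 Host
    line-representation = record
      { ⟦_⟧        = edge
      ; clique     = edge-clique
      ; size       = ∣edge∣≡2
      ; injective  = edge-injective
      ; surjective = edge-surjective
      ; adj⇒meet   = edge-adj⇒meet
      ; meet⇒adj   = edge-meet⇒adj
      }

    line⇒𝒦-upward : 2 ≤ k → 𝒦 G k
    line⇒𝒦-upward = tight⇒𝒦-upward (s≤s z≤n) line-representation host-tight

-- Paths and cycles as line graphs

toℕ-suc≡inject₁ : {i j : Fin n} → Fin.suc i ≡ inject₁ j → suc (toℕ i) ≡ toℕ j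
toℕ-suc≡inject₁ {j = j} eq = trans (cong toℕ eq) (Fin.toℕ-inject₁ j)

-- Vertex `i` of the path becomes the edge from `i` to `i + 1` in a path with one more vertex.
-- Values increase along directed walks, which rules out directed cycles.
path⇒𝒦-upward : ∀ n → 2 ≤ k → 𝒦 (Path n) k
path⇒𝒦-upward n = LineGraph.line⇒𝒦-upward inject₁ suc Fin.inject₁-injective Fin.suc-injective
  (λ i j i→j j→i → <-asym (step i→j) (step j→i))
  (λ i j l i→j j→l l→i → <-asym (<-trans (step i→j) (step j→l)) (step l→i))
  (λ i j → mk⇔ (Sum.map suc≡inject₁ suc≡inject₁) (Sum.map toℕ-suc≡inject₁ toℕ-suc≡inject₁))
  where
  step : {i j : Fin n} → Fin.suc i ≡ inject₁ j → toℕ i < toℕ j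
  step eq = ≤-reflexive (toℕ-suc≡inject₁ eq)
  suc≡inject₁ : {i j : Fin n} → suc (toℕ i) ≡ toℕ j → Fin.suc i ≡ inject₁ j
  suc≡inject₁ {j = j} eq = Fin.toℕ-injective (trans eq (sym (Fin.toℕ-inject₁ j)))

module _ {n : ℕ} where

  cyclicSucc-functional : {i j l : Fin n} → CyclicSucc i j → CyclicSucc i l → j ≡ l
  cyclicSucc-functional         (inj₁ e)       (inj₁ e′)       = Fin.toℕ-injective (trans (sym e) e′)
  cyclicSucc-functional {j = j} (inj₁ e)       (inj₂ (e′ , _)) = contradiction (trans (sym e) e′) (<⇒≢ (Fin.toℕ<n j))
  cyclicSucc-functional {l = l} (inj₂ (e , _)) (inj₁ e′)       = contradiction (trans (sym e′) e) (<⇒≢ (Fin.toℕ<n l))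
  cyclicSucc-functional         (inj₂ (_ , z)) (inj₂ (_ , z′)) = Fin.toℕ-injective (trans z (sym z′))

  cyclicSucc-injective : {i j l : Fin n} → CyclicSucc i l → CyclicSucc j l → i ≡ j
  cyclicSucc-injective (inj₁ e)       (inj₁ e′)       = Fin.toℕ-injective (suc-injective (trans e (sym e′)))
  cyclicSucc-injective (inj₁ e)       (inj₂ (_ , z))  = contradiction (trans e z) λ ()
  cyclicSucc-injective (inj₂ (_ , z)) (inj₁ e)        = contradiction (trans e z) λ ()
  cyclicSucc-injective (inj₂ (e , _)) (inj₂ (e′ , _)) = Fin.toℕ-injective (suc-injective (trans e (sym e′)))

  -- Without wrapping around, the values increase; one wrap forces `n = 2` and two wraps force
  -- `n = 1`.
  no-2-cyclicSucc : {i j : Fin n} → 3 ≤ n → CyclicSucc i j → ¬ CyclicSucc j i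
  no-2-cyclicSucc {i} {j} 3≤n i→j j→i = go (toℕ i) (toℕ j) i→j j→i 3≤n
    where
    go : ∀ a b → suc a ≡ b ⊎ (suc a ≡ n × b ≡ 0) → suc b ≡ a ⊎ (suc b ≡ n × a ≡ 0) → ¬ 3 ≤ n
    go _ _ (inj₁ refl)          (inj₁ e)             _ = <-asym (n<1+n _) (≤-reflexive e)
    go _ _ (inj₁ refl)          (inj₂ (refl , refl)) (s≤s (s≤s ()))
    go _ _ (inj₂ (refl , refl)) (inj₁ refl)          (s≤s (s≤s ()))
    go _ _ (inj₂ (_ , refl))    (inj₂ (refl , _))    (s≤s ())

  no-3-cyclicSucc : {i j l : Fin n} → 4 ≤ n → CyclicSucc i j → CyclicSucc j l → ¬ CyclicSucc l i
  no-3-cyclicSucc {i} {j} {l} 4≤n i→j j→l l→i = go (toℕ i) (toℕ j) (toℕ l) i→j j→l l→i 4≤n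
    where
    go : ∀ a b c → suc a ≡ b ⊎ (suc a ≡ n × b ≡ 0) → suc b ≡ c ⊎ (suc b ≡ n × c ≡ 0) →
      suc c ≡ a ⊎ (suc c ≡ n × a ≡ 0) → ¬ 4 ≤ n
    go _ _ _ (inj₁ refl)          (inj₁ refl)          (inj₁ e)             _ =
      <-asym (<-trans (n<1+n _) (n<1+n _)) (≤-reflexive e)
    go _ _ _ (inj₁ refl)          (inj₁ refl)          (inj₂ (refl , refl)) (s≤s (s≤s (s≤s ())))
    go _ _ _ (inj₁ refl)          (inj₂ (refl , refl)) (inj₁ refl)          (s≤s (s≤s (s≤s ())))
    go _ _ _ (inj₂ (refl , refl)) (inj₁ refl)          (inj₁ refl)          (s≤s (s≤s (s≤s ())))
    go _ _ _ (inj₂ (refl , _))    (inj₁ _)             (inj₂ (_ , refl))    (s≤s ())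
    go _ _ _ (inj₂ (_ , refl))    (inj₂ (refl , _))    _                    (s≤s ())

cyclicSucc-next : ∀ (i : Fin n) → ∃[ j ] CyclicSucc i j
cyclicSucc-next {suc n} i with suc (toℕ i) <? suc n
... | yes 1+i<n = fromℕ< 1+i<n , inj₁ (sym (Fin.toℕ-fromℕ< 1+i<n))
... | no 1+i≮n  = zero , inj₂ (≤-antisym (Fin.toℕ<n i) (≮⇒≥ 1+i≮n) , refl)

-- A cycle is its own line graph: vertex `i` becomes the edge from `i` to its cyclic successor. The
-- bound `4 ≤ n` keeps the host free of triangles.
cycle⇒𝒦-upward : ∀ n → 4 ≤ n → 2 ≤ k → 𝒦 (Cycle n) k
cycle⇒𝒦-upward n 4≤n = LineGraph.line⇒𝒦-upward (λ i → i) next (λ eq → eq)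
  (λ {i} {j} eq → cyclicSucc-injective (i→next i) (subst (CyclicSucc j) (sym eq) (i→next j)))
  (λ i j i→j j→i → no-2-cyclicSucc 3≤n (step i→j) (step j→i))
  (λ i j l i→j j→l l→i → no-3-cyclicSucc 4≤n (step i→j) (step j→l) (step l→i))
  (λ i j → mk⇔
    (λ (_ , i~j) → Sum.map (cyclicSucc-functional (i→next i)) (cyclicSucc-functional (i→next j)) i~j)
    (λ i~j → (λ { refl → Sum.[ loop , loop ] i~j }) , Sum.map step step i~j))
  where
  3≤n : 3 ≤ n
  3≤n = ≤-trans (n≤1+n 3) 4≤n
  next : Fin n → Fin n
  next i = proj₁ (cyclicSucc-next i)
  i→next : ∀ i → CyclicSucc i (next i)
  i→next i = proj₂ (cyclicSucc-next i)
  step : ∀ {i j} → next i ≡ j → CyclicSucc i j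
  step refl = i→next _
  loop : ∀ {i} → next i ≢ i
  loop i→i = no-2-cyclicSucc 3≤n (step i→i) (step i→i)

-- Vertex 0 is joined to all others and 1 to 2: a triangle with a pendant edge, written as a
-- threshold graph.
Paw : SimpleGraph (Fin 4)
Paw = record
  { Adj    = λ x y → x ≢ y × toℕ x + toℕ y ≤ 3
  ; adj?   = λ x y → ¬? (x Fin.≟ y) ×-dec (toℕ x + toℕ y ≤? 3)
  ; symm   = λ {x} {y} (x≢y , x+y≤3) → ≢-sym x≢y , subst (_≤ 3) (+-comm (toℕ x) (toℕ y)) x+y≤3
  ; irrefl = λ x≡y (x≢y , _) → x≢y x≡y
  }

-- The spine of the book is the pair of triangle edges at vertex 0; one page is the opposite edge
-- 12, the other the pendant edge 03.
paw-representation : Representation (Book 2) 2 Paw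
paw-representation = record
  { ⟦_⟧        = ⟦_⟧
  ; clique     = from-yes (∀⊎? λ v → isClique? Paw ⟦ v ⟧)
  ; size       = from-yes (∀⊎? λ v → ∣ ⟦ v ⟧ ∣ ≟ 2)
  ; injective  = λ {u} {v} → from-yes (∀⊎? λ u → ∀⊎? λ v →
      ≡-dec Bool._≟_ ⟦ u ⟧ ⟦ v ⟧ →-dec ⊎-≡-dec Fin._≟_ Fin._≟_ u v) u v
  ; surjective = surjective
  ; adj⇒meet   = λ {u} {v} → from-yes (∀⊎? λ u → ∀⊎? λ v →
      adj? (Book 2) u v →-dec (suc ∣ ⟦ u ⟧ ∩ ⟦ v ⟧ ∣ ≟ 2)) u v
  ; meet⇒adj   = λ {u} {v} → from-yes (∀⊎? λ u → ∀⊎? λ v →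
      (suc ∣ ⟦ u ⟧ ∩ ⟦ v ⟧ ∣ ≟ 2) →-dec adj? (Book 2) u v) u v
  }
  where
  ∀⊎? : {P : Fin 2 ⊎ Fin 2 → Set} → (∀ v → Dec (P v)) → Dec (∀ v → P v)
  ∀⊎? P? = map′ (λ (f , g) → Sum.[ f , g ]) (λ h → h ∘ inj₁ , h ∘ inj₂)
    (Fin.all? (P? ∘ inj₁) ×-dec Fin.all? (P? ∘ inj₂))

  ⟦_⟧ : Fin 2 ⊎ Fin 2 → Subset 4
  ⟦ inj₁ zero ⟧       = inside ∷ inside ∷ outside ∷ outside ∷ []
  ⟦ inj₁ (suc zero) ⟧ = inside ∷ outside ∷ inside ∷ outside ∷ []
  ⟦ inj₂ zero ⟧       = outside ∷ inside ∷ inside ∷ outside ∷ []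
  ⟦ inj₂ (suc zero) ⟧ = inside ∷ outside ∷ outside ∷ inside ∷ []

  surjective : ∀ S → IsClique Paw S → ∣ S ∣ ≡ 2 → ∃[ v ] ⟦ v ⟧ ≡ S
  surjective (inside  ∷ inside  ∷ outside ∷ outside ∷ []) _ _ = inj₁ zero , refl
  surjective (inside  ∷ outside ∷ inside  ∷ outside ∷ []) _ _ = inj₁ (suc zero) , refl
  surjective (outside ∷ inside  ∷ inside  ∷ outside ∷ []) _ _ = inj₂ zero , refl
  surjective (inside  ∷ outside ∷ outside ∷ inside  ∷ []) _ _ = inj₂ (suc zero) , refl
  -- The two nonedges 13 and 23 have label sums 4 and 5.
  surjective (outside ∷ inside  ∷ outside ∷ inside  ∷ []) c _ =
    contradiction (proj₂ (c (there here) (there (there (there here))) λ ())) (<⇒≱ ≤-refl)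
  surjective (outside ∷ outside ∷ inside  ∷ inside  ∷ []) c _ =
    contradiction (proj₂ (c (there (there here)) (there (there (there here))) λ ())) (<⇒≱ (n≤1+n 4))
  surjective (inside  ∷ inside  ∷ inside  ∷ inside  ∷ []) _ ()
  surjective (inside  ∷ inside  ∷ inside  ∷ outside ∷ []) _ ()
  surjective (inside  ∷ inside  ∷ outside ∷ inside  ∷ []) _ ()
  surjective (inside  ∷ outside ∷ inside  ∷ inside  ∷ []) _ ()
  surjective (inside  ∷ outside ∷ outside ∷ outside ∷ []) _ ()
  surjective (outside ∷ inside  ∷ inside  ∷ inside  ∷ []) _ ()
  surjective (outside ∷ inside  ∷ outside ∷ outside ∷ []) _ ()
  surjective (outside ∷ outside ∷ inside  ∷ outside ∷ []) _ ()
  surjective (outside ∷ outside ∷ outside ∷ inside  ∷ []) _ ()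
  surjective (outside ∷ outside ∷ outside ∷ outside ∷ []) _ ()

-- The families

module BookRepresentation {p k n : ℕ} {H : SimpleGraph (Fin n)} (R : Representation (Book p) k H) where
  open Representation R

  private
    spine : Adj (Book p) (inj₁ zero) (inj₁ (suc zero))
    spine ()

    loss : ∃[ x ] x ∈ ⟦ inj₁ zero ⟧ × x ∉ ⟦ inj₁ (suc zero) ⟧
    loss = exchange (meet-size R spine)

    gain : ∃[ x ] x ∈ ⟦ inj₁ (suc zero) ⟧ × x ∉ ⟦ inj₁ zero ⟧
    gain = exchange (meet-size R (≢-sym spine))

  a : Fin n
  a = proj₁ loss

  -- Pages are pairwise nonadjacent common neighbours of the two spine vertices, so no two of them
  -- are of the same kind with respect to `a`.
  pages-differ : ∀ {i j} → i ≢ j → (a ∈ ⟦ inj₂ i ⟧ → a ∈ ⟦ inj₂ j ⟧) → ¬ (a ∈ ⟦ inj₂ j ⟧ → a ∈ ⟦ inj₂ i ⟧)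
  pages-differ i≢j = common-neighbours⇒adj R spine (proj₁ (proj₂ loss)) (proj₂ (proj₂ loss))
    (proj₁ (proj₂ gain)) (proj₂ (proj₂ gain)) tt tt tt tt (i≢j ∘ inj₂-injective)

  fifth-vertex : ∀ {i j} → 3 ≤ k → a ∉ ⟦ inj₂ i ⟧ → a ∈ ⟦ inj₂ j ⟧ →
    ∃[ e ] e ≢ inj₁ zero × e ≢ inj₁ (suc zero) × e ≢ inj₂ i × e ≢ inj₂ j
  fifth-vertex 3≤k a∉i a∈j = another-vertex R spine (proj₁ (proj₂ loss)) (proj₂ (proj₂ loss))
    (proj₁ (proj₂ gain)) (proj₂ (proj₂ gain)) 3≤k a∉i tt tt a∈j

-- Exactly one of the two pages contains `a`, so for `k ≥ 3` a fifth vertex arises; the book has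
-- only four.
book₂-k≤2 : {H : SimpleGraph (Fin n)} → Representation (Book 2) k H → ¬ 3 ≤ k
book₂-k≤2 R 3≤k = go (a ∈? ⟦ inj₂ zero ⟧) (a ∈? ⟦ inj₂ (suc zero) ⟧)
  where
  open Representation R
  open BookRepresentation R
  exhausted : ∀ e → e ≢ inj₁ zero → e ≢ inj₁ (suc zero) → e ≢ inj₂ zero → ¬ e ≢ inj₂ (suc zero)
  exhausted (inj₁ zero)       e≢ _  _  _  = e≢ refl
  exhausted (inj₁ (suc zero)) _  e≢ _  _  = e≢ refl
  exhausted (inj₂ zero)       _  _  e≢ _  = e≢ refl
  exhausted (inj₂ (suc zero)) _  _  _  e≢ = e≢ refl
  go : Dec (a ∈ ⟦ inj₂ zero ⟧) → ¬ Dec (a ∈ ⟦ inj₂ (suc zero) ⟧)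
  go (yes ∈₀) (yes ∈₁) = pages-differ (λ ()) (λ _ → ∈₁) (λ _ → ∈₀)
  go (no ∉₀)  (no ∉₁)  = pages-differ (λ ()) (⊥-elim ∘ ∉₀) (⊥-elim ∘ ∉₁)
  go (no ∉₀)  (yes ∈₁) = let e , e≢u , e≢v , e≢0 , e≢1 = fifth-vertex 3≤k ∉₀ ∈₁ in exhausted e e≢u e≢v e≢0 e≢1
  go (yes ∈₀) (no ∉₁)  = let e , e≢u , e≢v , e≢1 , e≢0 = fifth-vertex 3≤k ∉₁ ∈₀ in exhausted e e≢u e≢v e≢0 e≢1

book₂ : 𝒦 (Book 2) ≐ ｛ 2 ｝
book₂ = k≡2 , λ { refl → representation⇒𝒦 (s≤s z≤n) paw-representation }
  where
  k≡2 : 𝒦 (Book 2) k → 2 ≡ k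
  k≡2 k∈@(1≤k , _) with _ , _ , R ← 𝒦⇒representation k∈
    with m≤n⇒m<n∨m≡n (nonadjacent⇒2≤k R {inj₂ zero} {inj₂ (suc zero)} (λ ()) (λ ()) 1≤k)
  ... | inj₁ 3≤k = contradiction 3≤k (book₂-k≤2 R)
  ... | inj₂ 2≡k = 2≡k

-- Pigeonhole: among three pages, two agree on `a`.
book₃₊ : {H : SimpleGraph (Fin n)} → ¬ Representation (Book (3 + m)) k H
book₃₊ R = go (a ∈? ⟦ inj₂ zero ⟧) (a ∈? ⟦ inj₂ (suc zero) ⟧) (a ∈? ⟦ inj₂ (suc (suc zero)) ⟧)
  where
  open Representation R
  open BookRepresentation R
  both : ∀ {i j} → i ≢ j → a ∈ ⟦ inj₂ i ⟧ → a ∉ ⟦ inj₂ j ⟧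
  both i≢j ∈i ∈j = pages-differ i≢j (λ _ → ∈j) (λ _ → ∈i)
  neither : ∀ {i j} → i ≢ j → a ∉ ⟦ inj₂ i ⟧ → ¬ a ∉ ⟦ inj₂ j ⟧
  neither i≢j ∉i ∉j = pages-differ i≢j (⊥-elim ∘ ∉i) (⊥-elim ∘ ∉j)
  go : Dec (a ∈ ⟦ inj₂ zero ⟧) → Dec (a ∈ ⟦ inj₂ (suc zero) ⟧) → ¬ Dec (a ∈ ⟦ inj₂ (suc (suc zero)) ⟧)
  go (yes ∈₀) (yes ∈₁) _        = both (λ ()) ∈₀ ∈₁
  go (yes ∈₀) (no ∉₁)  (yes ∈₂) = both (λ ()) ∈₀ ∈₂
  go (yes ∈₀) (no ∉₁)  (no ∉₂)  = neither (λ ()) ∉₁ ∉₂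
  go (no ∉₀)  (no ∉₁)  _        = neither (λ ()) ∉₀ ∉₁
  go (no ∉₀)  (yes ∈₁) (yes ∈₂) = both (λ ()) ∈₁ ∈₂
  go (no ∉₀)  (yes ∈₁) (no ∉₂)  = neither (λ ()) ∉₀ ∉₂

nonadjacent⇒𝒦⊆2≤ : {G : SimpleGraph V} (u v : V) → u ≢ v → ¬ Adj G u v → 𝒦 G k → 2 ≤ k
nonadjacent⇒𝒦⊆2≤ u v u≢v u≁v k∈@(1≤k , _) =
  let _ , _ , R = 𝒦⇒representation k∈ in nonadjacent⇒2≤k R u≢v u≁v 1≤k

path : ∀ n → 3 ≤ n → 𝒦 (Path n) ≐ (2 ≤_)
path n@(suc (suc (suc _))) (s≤s (s≤s (s≤s _))) =
  nonadjacent⇒𝒦⊆2≤ zero (suc (suc zero)) (λ ()) (λ { (inj₁ ()) ; (inj₂ ()) }) , path⇒𝒦-upward n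

cycle : ∀ n → 4 ≤ n → 𝒦 (Cycle n) ≐ (2 ≤_)
cycle n@(suc (suc (suc (suc _)))) 4≤n@(s≤s (s≤s (s≤s (s≤s _)))) =
  -- Since `n` is at least 4, vertex 2 is not the last one, so it is not adjacent to 0.
  nonadjacent⇒𝒦⊆2≤ zero (suc (suc zero)) (λ ())
    (λ { (_ , inj₁ (inj₁ ())) ; (_ , inj₁ (inj₂ (() , _))) ; (_ , inj₂ (inj₁ ())) ; (_ , inj₂ (inj₂ (() , _))) }) ,
  cycle⇒𝒦-upward n 4≤n

-- The leaves are `n` independent neighbours of the centre. Conversely, each leaf replaces its own
-- hub vertex, with `f` the identity.
star : ∀ n → 1 ≤ n → 𝒦 (CompleteBipartite 1 n) ≐ (n ≤_)
star n 1≤n =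
  (λ k∈ → let _ , _ , R = 𝒦⇒representation k∈ in
    IndependentNeighbours.count≤k R {c = inj₁ zero} inj₂ (λ _ → tt) inj₂-injective (λ _ _ ())) ,
  windmill⇒𝒦-upward (↔-id (Fin n)) (λ i → i) (λ _ → tt)
    (λ _ _ → mk⇔ (λ ()) (λ (i≢j , i≡j) → i≢j i≡j)) 1≤n

completeBipartite-∅ : ∀ m n → 2 ≤ m → 3 ≤ n → 𝒦 (CompleteBipartite m n) ≐ ∅
completeBipartite-∅ (suc (suc m)) n (s≤s (s≤s _)) 3≤n =
  (λ k∈ → let _ , _ , R = 𝒦⇒representation k∈ in
    no-K₂₃ R {inj₁ zero} {inj₁ (suc zero)} (λ ()) (λ ()) (λ i → inj₂ (inject≤ i 3≤n)) (λ _ → tt) (λ _ → tt)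
      (λ eq → Fin.inject≤-injective 3≤n 3≤n _ _ (inj₂-injective eq)) (λ _ _ ())) ,
  λ ()

-- One end of each edge of the matching gives `p` independent neighbours of the centre. Conversely,
-- both ends of edge `i` replace the hub vertex `i`.
friendship : ∀ p → 1 ≤ p → 𝒦 (Friendship p) ≐ (p ≤_)
friendship p 1≤p =
  (λ k∈ → let _ , _ , R = 𝒦⇒representation k∈ in
    IndependentNeighbours.count≤k R {c = inj₁ zero} (λ i → inj₂ (i , zero)) (λ _ → tt)
      (cong proj₁ ∘ inj₂-injective) (λ _ _ (_ , 0≢0) → 0≢0 refl)) ,
  windmill⇒𝒦-upward (↔-sym Fin.*↔×) proj₁ (λ _ → tt)
    (λ (i , a) (j , b) → mk⇔ (λ (i≡j , a≢b) → (a≢b ∘ cong proj₂) , i≡j)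
                             (λ (ia≢jb , i≡j) → i≡j , λ a≡b → ia≢jb (cong₂ _,_ i≡j a≡b))) 1≤p

theorem4p8 : (∀ n → 1 ≤ n → 𝒦 (Complete n) ≐ (1 ≤_))
    × ((𝒦 (Path 2) ≐ (1 ≤_))
    × (∀ n → 3 ≤ n → 𝒦 (Path n) ≐ (2 ≤_))
    × (𝒦 (Cycle 3) ≐ (1 ≤_))
    × (∀ n → 4 ≤ n → 𝒦 (Cycle n) ≐ (2 ≤_)))
    × ((𝒦 (CompleteBipartite 1 1) ≐ (1 ≤_))
    × (𝒦 (CompleteBipartite 1 2) ≐ (2 ≤_))
    × (∀ n → 3 ≤ n → 𝒦 (CompleteBipartite 1 n) ≐ (n ≤_))
    × (∀ m n → 2 ≤ m → m ≤ n → 3 ≤ n → 𝒦 (CompleteBipartite m n) ≐ ∅))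
    × ((𝒦 (Book 1) ≐ (1 ≤_))
    × (𝒦 (Book 2) ≐ ｛ 2 ｝)
    × (∀ p → 3 ≤ p → 𝒦 (Book p) ≐ ∅))
    × ((𝒦 (Friendship 1) ≐ (1 ≤_))
    × (∀ p → 2 ≤ p → 𝒦 (Friendship p) ≐ (p ≤_)))
theorem4p8 =
  (λ n _ → 𝒦-complete (↔-id (Fin n)) λ _ _ u≢v → u≢v) ,
  ( 𝒦-complete (↔-id (Fin 2)) (from-yes (Fin.all? λ u → Fin.all? λ v → ¬? (u Fin.≟ v) →-dec adj? (Path 2) u v))
  , path
  , 𝒦-complete (↔-id (Fin 3)) (from-yes (Fin.all? λ u → Fin.all? λ v → ¬? (u Fin.≟ v) →-dec adj? (Cycle 3) u v))
  , cycle ) ,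
  ( star 1 ≤-refl
  , star 2 (s≤s z≤n)
  , (λ n 3≤n → star n (≤-trans (s≤s z≤n) 3≤n))
  , (λ m n 2≤m _ 3≤n → completeBipartite-∅ m n 2≤m 3≤n) ) ,
  ( 𝒦-complete (↔-sym Fin.+↔⊎) (λ
      { (inj₁ _)    (inj₁ _)    u≢v → u≢v ∘ cong inj₁
      ; (inj₁ _)    (inj₂ _)    _   → tt
      ; (inj₂ _)    (inj₁ _)    _   → tt
      ; (inj₂ zero) (inj₂ zero) u≢v → u≢v refl })
  , book₂
  , λ { (suc (suc (suc _))) (s≤s (s≤s (s≤s _))) →
          (λ k∈ → book₃₊ (proj₂ (proj₂ (𝒦⇒representation k∈)))) , λ () } ) ,
  friendship 1 ≤-refl ,
  λ p 2≤p → friendship p (≤-trans (s≤s z≤n) 2≤p)
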